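{- Let $\alpha\ge3$, $q\ge2$ and $0\le\rho<\alpha$ be integers, and let $b$ be the balanced cyclic binary word of length $\alpha$ with exactly $\rho$ ones (unique up to rotation). Every cyclic binary word $w$ of length $\alpha$ with exactly $\rho$ ones satisfies $$I(C_q(w);x)\preceq_{\mathrm{cf}} I(C_q(b);x),$$ with equality if and only if $w$ is balanced. More precisely, if $w$ is not balanced and $r$ is its least imbalance length, then $$i_j(C_q(w))=i_j(C_q(b))\quad(0\le j<2r),\qquad i_j(C_q(w))<i_j(C_q(b))\quad(2r\le j\le\alpha).$$
   Context: All graphs are finite and simple. $i_j(G)$ is the number of independent sets of $G$ of cardinality $j$, and $I(G;x)=\sum_{j\ge 0} i_j(G)x^j$. For $f,g\in\mathbb Z[x]$, $f\preceq_{\mathrm{cf}} g$ means that every coefficient of $f$ is at most the corresponding coefficient of $g$. Graphs $C_q(w)$: let $\alpha\ge3$, $q\ge2$, and let $w=w_0\cdots w_{\alpha-1}$ be a binary word. Take disjoint cliques $C_i\cong K_{q+w_i}$ for $i\in\mathbb Z/\alpha\mathbb Z$, choose distinct vertices $x_i,y_i\in C_i$ for each $i$, and add the linking edges $y_ix_{i+1}$ for all $i\in\mathbb Z/\alpha\mathbb Z$ (indices modulo $\alpha$). The resulting graph is $C_q(w)$; up to isomorphism it does not depend on the choice of $x_i,y_i$, nor on rotating or reversing $w$. A cyclic binary word is a binary word considered up to rotation; its cyclic factors are the contiguous factors of its periodic extension. It is balanced if any two cyclic factors of the same length contain numbers of $1$'s differing by at most one. If it is not balanced, its least imbalance length is the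 least $r$ such that some two cyclic factors of length $r$ contain numbers of $1$'s differing by at least two. The balanced cyclic word $b$ is given by $b_i=\lfloor (i+1)\rho/\alpha\rfloor-\lfloor i\rho/\alpha\rfloor$ for $0\le i<\alpha$. -}

module Defs where

open import Data.Fin.Base as Fin using (Fin; toℕ; fromℕ<)
import Data.Fin.Properties as Fin
open import Data.Integer.Base as ℤ using (ℤ; +_; 0ℤ)
open import Data.List.Base as List using (List; []; _∷_; _++_; map; concat; length; filter; allFin; upTo)
open import Data.List.Membership.Propositional using (_∈_)
open import Data.List.Membership.Propositional.Properties using (∈-allFin; ∈-map⁺; ∈-map⁻; ∈-concat⁺′)
import Data.List.Relation.Unary.All.Properties as All
open import Data.List.Relation.Unary.AllPairs as AllPairs using (AllPairs)
import Data.List.Relation.Unary.AllPairs.Properties as AllPairs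
open import Data.List.Relation.Unary.Unique.Propositional using (Unique)
import Data.List.Relation.Unary.Unique.Propositional.Properties as Unique
open import Data.Nat.Base
open import Data.Nat.DivMod using (_mod_; /-monoˡ-≤; n/n≡1; +-distrib-/-∣ʳ)
open import Data.Nat.Divisibility using (∣-refl)
open import Data.Nat.Properties hiding (_≟_)
import Data.Nat.Properties as ℕ
open import Data.Product.Base using (Σ; ∃; ∃₂; _×_; _,_; proj₁; proj₂)
open import Data.Product.Properties using (≡-dec)
open import Data.Sum.Base using (_⊎_; inj₁; inj₂)
open import Data.Vec.Base as Vec using (Vec; lookup; tabulate)
open import Relation.Binary.Definitions using (Decidable; Symmetric)
open import Relation.Binary.PropositionalEquality
open import Relation.Nullary using (Dec; ¬_; ¬?; _×-dec_; _⊎-dec_)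

------------------------------------------------------------------------
-- Finite simple graphs and independent sets

record Graph : Set₁ where
  field
    V        : Set
    vertices : List V
    complete : ∀ v → v ∈ vertices
    unique   : Unique vertices
    Adj      : V → V → Set
    adj?     : Decidable Adj
    symm     : Symmetric Adj
    irrefl   : ∀ v → ¬ Adj v v

-- The sublists of a list.  As the vertices of a graph are listed without
-- repetition, the sublists of that list represent each vertex set once.
subsets : ∀ {A : Set} → List A → List (List A)
subsets []       = [] ∷ []
subsets (x ∷ xs) = map (x ∷_) (subsets xs) ++ subsets xs

module _ (G : Graph) where
  open Graph G

  -- Checking each unordered pair once is enough: Adj is symmetric and
  -- irreflexive.
  Independent : List V → Set
  Independent = AllPairs (λ u v → ¬ Adj u v)

  independent? : ∀ S → Dec (Independent S)
  independent? = AllPairs.allPairs? (λ u v → ¬? (adj? u v))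

  indepCount : ℕ → ℕ
  indepCount j = length (filter (λ S → independent? S ×-dec length S ℕ.≟ j) (subsets vertices))

------------------------------------------------------------------------
-- Integer polynomials, as lists of coefficients (constant term first)

Polynomial : Set
Polynomial = List ℤ

coeff : Polynomial → ℕ → ℤ
coeff []      _       = 0ℤ
coeff (a ∷ f) zero    = a
coeff (a ∷ f) (suc j) = coeff f j

infix 4 _≈_ _⪯cf_

-- Equality of polynomials; trailing zeros in the lists are irrelevant.
_≈_ : Polynomial → Polynomial → Set
f ≈ g = ∀ j → coeff f j ≡ coeff g j

_⪯cf_ : Polynomial → Polynomial → Set
f ⪯cf g = ∀ j → coeff f j ℤ.≤ coeff g j

-- An independent set has at most as many elements as there are vertices,
-- so the sum over j ≥ 0 may stop at the number of vertices.
I : Graph → Polynomial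
I G = map (λ j → + indepCount G j) (upTo (suc (length (Graph.vertices G))))

------------------------------------------------------------------------
-- Binary words and their cyclic factors

-- A cyclic word is handled through its representatives; all the notions
-- applied to words below are invariant under rotation.
Word : ℕ → Set
Word = Vec (Fin 2)

ones : ∀ {n} → Word n → ℕ
ones w = Vec.sum (Vec.map toℕ w)

module _ {α : ℕ} .{{_ : NonZero α}} where

  -- The factor of length r of the periodic extension of w, starting at i.
  -- The length r may exceed α.
  factor : Word α → ℕ → (r : ℕ) → Word r
  factor w i r = tabulate (λ k → lookup w ((i + toℕ k) mod α))

  infix 4 _IsRotationOf_

  _IsRotationOf_ : Word α → Word α → Set
  w IsRotationOf v = ∃ λ i → w ≡ factor v i α

  Balanced : Word α → Set
  Balanced w = ∀ r i j → ∣ ones (factor w i r) - ones (factor w j r) ∣ ≤ 1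

  ImbalancedAt : Word α → ℕ → Set
  ImbalancedAt w r = ∃₂ λ i j → 2 ≤ ∣ ones (factor w i r) - ones (factor w j r) ∣

  IsLeastImbalanceLength : Word α → ℕ → Set
  IsLeastImbalanceLength w r = ImbalancedAt w r × (∀ s → s < r → ¬ ImbalancedAt w s)

module _ (α ρ : ℕ) .{{_ : NonZero α}} where

  -- Truncated subtraction is harmless here, since the quotients increase
  -- with i.
  balancedLetter : ℕ → ℕ
  balancedLetter i = (suc i * ρ) / α ∸ (i * ρ) / α

  balancedLetter<2 : ρ < α → ∀ i → balancedLetter i < 2
  balancedLetter<2 ρ<α i = s≤s (begin
    (ρ + i * ρ) / α ∸ (i * ρ) / α        ≤⟨ ∸-monoˡ-≤ ((i * ρ) / α) step ⟩
    ((i * ρ) / α + 1) ∸ (i * ρ) / α      ≡⟨ m+n∸m≡n ((i * ρ) / α) 1 ⟩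
    1                                    ∎)
    where
    open ≤-Reasoning
    step : (ρ + i * ρ) / α ≤ (i * ρ) / α + 1
    step = begin
      (ρ + i * ρ) / α        ≤⟨ /-monoˡ-≤ α (+-monoˡ-≤ (i * ρ) (<⇒≤ ρ<α)) ⟩
      (α + i * ρ) / α        ≡⟨ cong (_/ α) (+-comm α (i * ρ)) ⟩
      (i * ρ + α) / α        ≡⟨ +-distrib-/-∣ʳ (i * ρ) ∣-refl ⟩
      (i * ρ) / α + α / α    ≡⟨ cong (λ k → (i * ρ) / α + k) (n/n≡1 α) ⟩
      (i * ρ) / α + 1        ∎

  balancedWord : .(ρ < α) → Word α
  balancedWord ρ<α = tabulate (λ i → fromℕ< (balancedLetter<2 ρ<α (toℕ i)))

------------------------------------------------------------------------
-- The graphs C_q(w)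

module _ {α : ℕ} .{{_ : NonZero α}} (q : ℕ) (w : Word α) where

  cliqueSize : Fin α → ℕ
  cliqueSize i = q + toℕ (lookup w i)

  CVertex : Set
  CVertex = Σ (Fin α) (λ i → Fin (cliqueSize i))

  next : Fin α → Fin α
  next i = suc (toℕ i) mod α

  SameClique : CVertex → CVertex → Set
  SameClique u v = proj₁ u ≡ proj₁ v × u ≢ v

  -- The linking edges y_i x_{i+1}, with x_i and y_i the vertices numbered
  -- 0 and 1 of the i-th clique (both exist when q ≥ 2).
  Link : CVertex → CVertex → Set
  Link (i , u) (j , v) = j ≡ next i × toℕ u ≡ 1 × toℕ v ≡ 0

  CAdj : CVertex → CVertex → Set
  CAdj u v = SameClique u v ⊎ Link u v ⊎ Link v u

  link? : Decidable Link
  link? (i , u) (j , v) = j Fin.≟ next i ×-dec toℕ u ℕ.≟ 1 ×-dec toℕ v ℕ.≟ 0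

  cadj? : Decidable CAdj
  cadj? u v = (proj₁ u Fin.≟ proj₁ v ×-dec ¬? (≡-dec Fin._≟_ Fin._≟_ u v))
              ⊎-dec link? u v ⊎-dec link? v u

  link-irrefl : ∀ v → ¬ Link v v
  link-irrefl v (_ , v≡1 , v≡0) with () ← trans (sym v≡1) v≡0

  cadj-symm : Symmetric CAdj
  cadj-symm (inj₁ (i≡j , u≢v)) = inj₁ (sym i≡j , λ v≡u → u≢v (sym v≡u))
  cadj-symm (inj₂ (inj₁ l))    = inj₂ (inj₂ l)
  cadj-symm (inj₂ (inj₂ l))    = inj₂ (inj₁ l)

  cadj-irrefl : ∀ v → ¬ CAdj v v
  cadj-irrefl v (inj₁ (_ , v≢v)) = v≢v refl
  cadj-irrefl v (inj₂ (inj₁ l))  = link-irrefl v l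
  cadj-irrefl v (inj₂ (inj₂ l))  = link-irrefl v l

  clique : Fin α → List CVertex
  clique i = map (i ,_) (allFin (cliqueSize i))

  cliques : List CVertex
  cliques = concat (map clique (allFin α))

  cliques-complete : ∀ v → v ∈ cliques
  cliques-complete (i , u) =
    ∈-concat⁺′ (∈-map⁺ (i ,_) (∈-allFin u)) (∈-map⁺ clique (∈-allFin i))

  cliques-unique : Unique cliques
  cliques-unique = Unique.concat⁺
    (All.map⁺ (All.tabulate⁺ λ i → Unique.map⁺ (λ where refl → refl) (Unique.allFin⁺ (cliqueSize i))))
    (AllPairs.map⁺ (AllPairs.map disjoint (Unique.allFin⁺ α)))
    where
    disjoint : ∀ {i j} → i ≢ j → ∀ {v} → ¬ (v ∈ clique i × v ∈ clique j)
    disjoint i≢j (v∈i , v∈j) with ∈-map⁻ _ v∈i | ∈-map⁻ _ v∈j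
    ... | _ , _ , p | _ , _ , p′ = i≢j (trans (sym (cong proj₁ p)) (cong proj₁ p′))

  C : Graph
  C = record
    { V        = CVertex
    ; vertices = cliques
    ; complete = cliques-complete
    ; unique   = cliques-unique
    ; Adj      = CAdj
    ; adj?     = cadj?
    ; symm     = λ {u} {v} → cadj-symm {u} {v}
    ; irrefl   = cadj-irrefl
    }

{-# OPTIONS --safe #-}
-- Scanning the cliques in order turns i_j(C_q(w)) into a coefficient of the
-- trace of a product of 2 × 2 matrices over ℕ[[x]], one for each letter of w.
-- If w is not balanced and r is its least imbalance length, then up to
-- rotation w = 1p1X0p0Y with a palindrome p of length r − 2.  Reversing the
-- factor p1X0p gives w′ = 1p0X̃1p0Y.  Up to reversal the factors of w′ of length
-- less than r are factors of w, so the least imbalance length does not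
-- decrease.  Reversing a word transposes its matrix product up to a fixed
-- change of basis, hence the two traces differ by the product of the
-- antisymmetric parts belonging to p1X0p and 0Y1.  The outer letters p
-- contribute their determinants x² to the former, and the difference is
-- x^{2r} F G, where F and G have positive coefficients up to the degrees |X|
-- and |Y|, and 2r + |X| + |Y| = α.  Repeating the step increases i_α each time,
-- so it ends in a balanced word, which is a rotation of b.
module Submission where

open import Algebra.Bundles using (CommutativeSemiring)

-- The strict inequalities need a difference of traces whose coefficients are visibly nonnegative.
-- Hence everything stays over ℕ[[x]]: a difference is an equation A + κ = B, and κ is positive by
-- its form. Reversing a block with equal outer letters would leave the sign of κ open. It is the
-- imbalance that fixes the sign: the outer letters of 1X0 and of 0Y1 differ, and the extra x in the
-- weight of the letter 1 cancels the only negative term.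
--
-- The shape of w comes from the minimality of r. A common part of two factors that differ by two
-- could be removed, leaving shorter factors with the same difference, so the two factors are
-- disjoint. Each proper prefix of the first one leads by exactly one over its counterpart, which
-- leaves no freedom except in the common inner word p.
--
-- A step with least imbalance length r changes no coefficient below 2r. As r never drops from one
-- word of the chain to the next, all coefficients below the 2r of the initial word are already
-- those of b, and every coefficient from there up to α is strictly increased by the initial step
-- alone.

module Matrices {c ℓ} (R : CommutativeSemiring c ℓ) where

  open CommutativeSemiring R
  open import Algebra.Solver.Ring.NaturalCoefficients.Default R
  open import Relation.Binary.Reasoning.Setoid setoid

  -- Matrices of size two over a commutative semiring

  infix 4 _≋_
  infixl 7 _·_

  record Mat : Set c where
    constructor mat
    field e₁₁ e₁₂ e₂₁ e₂₂ : Carrier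

  open Mat public

  record _≋_ (M N : Mat) : Set ℓ where
    constructor mat≋
    field
      ≈₁₁ : e₁₁ M ≈ e₁₁ N
      ≈₁₂ : e₁₂ M ≈ e₁₂ N
      ≈₂₁ : e₂₁ M ≈ e₂₁ N
      ≈₂₂ : e₂₂ M ≈ e₂₂ N

  open _≋_ public

  _·_ : Mat → Mat → Mat
  mat a b c d · mat a′ b′ c′ d′ =
    mat (a * a′ + b * c′) (a * b′ + b * d′) (c * a′ + d * c′) (c * b′ + d * d′)

  Id : Mat
  Id = mat 1# 0# 0# 1#

  tr : Mat → Carrier
  tr M = e₁₁ M + e₂₂ M

  ≋-refl : ∀ {M} → M ≋ M
  ≋-refl = mat≋ refl refl refl refl

  ≋-sym : ∀ {M N} → M ≋ N → N ≋ M
  ≋-sym (mat≋ p q r s) = mat≋ (sym p) (sym q) (sym r) (sym s)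

  ≋-trans : ∀ {L M N} → L ≋ M → M ≋ N → L ≋ N
  ≋-trans (mat≋ p q r s) (mat≋ p′ q′ r′ s′) = mat≋ (trans p p′) (trans q q′) (trans r r′) (trans s s′)

  ·-cong : ∀ {M M′ N N′} → M ≋ M′ → N ≋ N′ → M · N ≋ M′ · N′
  ·-cong (mat≋ p q r s) (mat≋ p′ q′ r′ s′) = mat≋
    (+-cong (*-cong p p′) (*-cong q r′)) (+-cong (*-cong p q′) (*-cong q s′))
    (+-cong (*-cong r p′) (*-cong s r′)) (+-cong (*-cong r q′) (*-cong s s′))

  ·-identityˡ : ∀ M → Id · M ≋ M
  ·-identityˡ (mat a b c d) = mat≋ (on a c) (on b d) (off a c) (off b d)
    where
    on  = solve 2 (λ a c → con 1 :* a :+ con 0 :* c := a) refl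
    off = solve 2 (λ a c → con 0 :* a :+ con 1 :* c := c) refl

  ·-identityʳ : ∀ M → M · Id ≋ M
  ·-identityʳ (mat a b c d) = mat≋ (on a b) (off a b) (on c d) (off c d)
    where
    on  = solve 2 (λ a b → a :* con 1 :+ b :* con 0 := a) refl
    off = solve 2 (λ a b → a :* con 0 :+ b :* con 1 := b) refl

  ·-assoc : ∀ L M N → (L · M) · N ≋ L · (M · N)
  ·-assoc (mat a b c d) (mat a′ b′ c′ d′) (mat a″ b″ c″ d″) =
    mat≋ (entry a b a″ c″) (entry a b b″ d″) (entry c d a″ c″) (entry c d b″ d″)
    where
    entry = λ a b u v → solve 8
      (λ a b a′ b′ c′ d′ u v → (a :* a′ :+ b :* c′) :* u :+ (a :* b′ :+ b :* d′) :* v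
                             := a :* (a′ :* u :+ b′ :* v) :+ b :* (c′ :* u :+ d′ :* v))
      refl a b a′ b′ c′ d′ u v

  tr-cong : ∀ {M N} → M ≋ N → tr M ≈ tr N
  tr-cong (mat≋ p _ _ s) = +-cong p s

  tr-comm : ∀ M N → tr (M · N) ≈ tr (N · M)
  tr-comm (mat a b c d) (mat a′ b′ c′ d′) = solve 8
    (λ a b c d a′ b′ c′ d′ → (a :* a′ :+ b :* c′) :+ (c :* b′ :+ d :* d′)
                           := (a′ :* a :+ b′ :* c) :+ (c′ :* b :+ d′ :* d))
    refl a b c d a′ b′ c′ d′

  -- N′ J = (N J)ᵀ for J = (1 1; 1 0), the change of basis in which all the
  -- matrices T s below are symmetric: T s J = (T s J)ᵀ.
  record Reversal (N N′ : Mat) : Set ℓ where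
    constructor reversal
    field
      r₁₁ : e₁₁ N′ + e₁₂ N′ ≈ e₁₁ N + e₁₂ N
      r₁₂ : e₁₁ N′ ≈ e₂₁ N + e₂₂ N
      r₂₁ : e₂₁ N′ + e₂₂ N′ ≈ e₁₁ N
      r₂₂ : e₂₁ N′ ≈ e₂₁ N

  reversal-Id : Reversal Id Id
  reversal-Id = reversal refl (sym (+-identityˡ 1#)) (+-identityˡ 1#) refl

  -- As J is symmetric, N′M′J = (N J)ᵀ J⁻¹ (M J)ᵀ = (M N J)ᵀ. The computation by entries avoids J⁻¹,
  -- which has a negative entry.
  reversal-· : ∀ {M M′ N N′} → Reversal M M′ → Reversal N N′ → Reversal (M · N) (N′ · M′)
  reversal-· {mat a b c d} {mat a′ b′ c′ d′} {mat e f g h} {mat e′ f′ g′ h′}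
        (reversal p₁₁ p₁₂ p₂₁ p₂₂) (reversal q₁₁ q₁₂ q₂₁ q₂₂) = reversal
    (begin
      e′ * a′ + f′ * c′ + (e′ * b′ + f′ * d′)   ≈⟨ collect e′ f′ a′ c′ b′ d′ ⟩
      e′ * (a′ + b′) + f′ * (c′ + d′)           ≈⟨ +-cong (*-congˡ p₁₁) (*-congˡ p₂₁) ⟩
      e′ * (a + b) + f′ * a                     ≈⟨ exchange a b e′ f′ ⟩
      a * (e′ + f′) + b * e′                    ≈⟨ +-cong (*-congˡ q₁₁) (*-congˡ q₁₂) ⟩
      a * (e + f) + b * (g + h)                 ≈⟨ collect a b e g f h ⟨
      a * e + b * g + (a * f + b * h)           ∎)
    (begin
      e′ * a′ + f′ * c′                         ≈⟨ +-cong (*-congˡ p₁₂) (*-congˡ p₂₂) ⟩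
      e′ * (c + d) + f′ * c                     ≈⟨ exchange c d e′ f′ ⟩
      c * (e′ + f′) + d * e′                    ≈⟨ +-cong (*-congˡ q₁₁) (*-congˡ q₁₂) ⟩
      c * (e + f) + d * (g + h)                 ≈⟨ collect c d e g f h ⟨
      c * e + d * g + (c * f + d * h)           ∎)
    (begin
      g′ * a′ + h′ * c′ + (g′ * b′ + h′ * d′)   ≈⟨ collect g′ h′ a′ c′ b′ d′ ⟩
      g′ * (a′ + b′) + h′ * (c′ + d′)           ≈⟨ +-cong (*-congˡ p₁₁) (*-congˡ p₂₁) ⟩
      g′ * (a + b) + h′ * a                     ≈⟨ exchange a b g′ h′ ⟩
      a * (g′ + h′) + b * g′                    ≈⟨ +-cong (*-congˡ q₂₁) (*-congˡ q₂₂) ⟩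
      a * e + b * g                             ∎)
    (begin
      g′ * a′ + h′ * c′                         ≈⟨ +-cong (*-congˡ p₁₂) (*-congˡ p₂₂) ⟩
      g′ * (c + d) + h′ * c                     ≈⟨ exchange c d g′ h′ ⟩
      c * (g′ + h′) + d * g′                    ≈⟨ +-cong (*-congˡ q₂₁) (*-congˡ q₂₂) ⟩
      c * e + d * g                             ∎)
    where
    collect : ∀ u v w x y z → u * w + v * x + (u * y + v * z) ≈ u * (w + y) + v * (x + z)
    collect = solve 6 (λ u v w x y z →
      u :* w :+ v :* x :+ (u :* y :+ v :* z) := u :* (w :+ y) :+ v :* (x :+ z)) refl
    exchange : ∀ u v y z → y * (u + v) + z * u ≈ u * (y + z) + v * y
    exchange = solve 4 (λ u v y z → y :* (u :+ v) :+ z :* u := u :* (y :+ z) :+ v :* y) refl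

  reversal-respʳ : ∀ {N N′ N″} → N′ ≋ N″ → Reversal N N′ → Reversal N N″
  reversal-respʳ (mat≋ p q r s) (reversal r₁₁ r₁₂ r₂₁ r₂₂) = reversal
    (trans (+-cong (sym p) (sym q)) r₁₁) (trans (sym p) r₁₂) (trans (+-cong (sym r) (sym s)) r₂₁)
        (trans (sym r) r₂₂)

  -- Transfer matrices and antisymmetric parts

  module Letters (x : Carrier) where

    -- Transfer matrix of a clique: the row says whether the last vertex y of
    -- the previous clique is chosen, which excludes the first vertex of this
    -- one, and the column whether the last vertex of this one is chosen.
    T : Carrier → Mat
    T s = mat (s + x) x s x

    reversal-T : ∀ s → Reversal (T s) (T s)
    reversal-T s = reversal refl refl refl refl

    -- `T (s + x)` is `T s` plus x times the matrix (1 0; 1 0). For M = (a b; c d) the first summand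
    -- contributes x²(c + d - a), as in `sandwich`, and the second x²(a + b), so that the negative
    -- term cancels. With s the weight of the letter 0, the outer matrices are those of the letters
    -- 1 and 0.
    core : ∀ s M → let Q = T (s + x) · M · T s in
      e₁₁ Q + x * (x * (e₁₂ M + (e₂₁ M + e₂₂ M))) ≈ e₂₁ Q + e₂₂ Q
    core s (mat a b c d) = solve 6
      (λ s x a b c d →
        let u = (s :+ x :+ x) :* a :+ x :* c
            v = (s :+ x :+ x) :* b :+ x :* d
            w = (s :+ x) :* a :+ x :* c
            z = (s :+ x) :* b :+ x :* d in
        u :* (s :+ x) :+ v :* s :+ x :* (x :* (b :+ (c :+ d)))
        := (w :* (s :+ x) :+ z :* s) :+ (w :* x :+ z :* x))
      refl s x a b c d

    -- Symmetry of `T s` J gives `T s · Q · T s` J = `T s` (Q J) (`T s`)ᵀ, and a congruence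
    -- multiplies the antisymmetric part of a matrix of size two by the determinant, here (s + x)x -
    -- xs = x².
    sandwich : ∀ s Q κ → e₁₁ Q + κ ≈ e₂₁ Q + e₂₂ Q →
      let N = T s · Q · T s in e₁₁ N + x * (x * κ) ≈ e₂₁ N + e₂₂ N
    sandwich s (mat a b c d) κ eq = begin
      ((s + x) * a + x * c) * (s + x) + ((s + x) * b + x * d) * s + x * (x * κ)
        ≈⟨ solve 7 (λ s x a b c d κ → ((s :+ x) :* a :+ x :* c) :* (s :+ x) :+
            ((s :+ x) :* b :+ x :* d) :* s :+ x :* (x :* κ)
             := s :* (s :+ x) :* (a :+ b) :+ s :* x :* a :+ x :* s :*
                 (c :+ d) :+ x :* x :* c :+ x :* x :* (a :+ κ)) refl s x a b c d κ ⟩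
      s * (s + x) * (a + b) + s * x * a + x * s * (c + d) + x * x * c + x * x * (a + κ)
        ≈⟨ +-congˡ (*-congˡ eq) ⟩
      s * (s + x) * (a + b) + s * x * a + x * s * (c + d) + x * x * c + x * x * (c + d)
        ≈⟨ solve 6 (λ s x a b c d → s :* (s :+ x) :* (a :+ b) :+ s :* x :* a :+ x :* s :*
            (c :+ d) :+ x :* x :* c :+ x :* x :* (c :+ d)
             := ((s :* a :+ x :* c) :* (s :+ x) :+ (s :* b :+ x :* d) :* s) :+
                 ((s :* a :+ x :* c) :* x :+ (s :* b :+ x :* d) :* x)) refl s x a b c d ⟩
      (s * a + x * c) * (s + x) + (s * b + x * d) * s + ((s * a + x * c) * x + (s * b + x * d) * x) ∎

  -- κ and κ′ are, up to sign, the antisymmetric parts of N J and Z J, with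
  -- both sides moved so that no subtraction occurs.
  tr-reversal : ∀ {N N′} Z κ κ′ → Reversal N N′ →
    (∀ {u v w} → u + v ≈ u + w → v ≈ w) →
    e₁₁ N + κ ≈ e₂₁ N + e₂₂ N → e₂₁ Z + e₂₂ Z + κ′ ≈ e₁₁ Z →
    tr (N′ · Z) ≈ tr (N · Z) + κ * κ′
  tr-reversal {mat a b c d} {mat a′ b′ c′ d′} (mat e f g h) κ κ′
      (reversal r₁₁ r₁₂ r₂₁ r₂₂) cancel p q = begin
    -- Reversal raises a by κ, lowers b and d by κ and keeps c, so the trace grows by κ(e - g - h) =
    -- κκ′.
    a′ * e + b′ * g + (c′ * f + d′ * h)
      ≈⟨ +-cong (+-congʳ (*-cong a′≈ (sym q))) (+-congʳ (*-congʳ r₂₂)) ⟩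
    (a + κ) * (g + h + κ′) + b′ * g + (c * f + d′ * h)
      ≈⟨ solve 9 (λ a b′ c d′ f g h κ κ′ → (a :+ κ) :* (g :+ h :+ κ′) :+ b′ :* g :+ (c :* f :+ d′ :* h)
           := a :* (g :+ h :+ κ′) :+ (b′ :+ κ) :* g :+ (c :* f :+ (d′ :+ κ) :* h) :+ κ :* κ′)
               refl a b′ c d′ f g h κ κ′ ⟩
    a * (g + h + κ′) + (b′ + κ) * g + (c * f + (d′ + κ) * h) + κ * κ′
      ≈⟨ +-congʳ (+-cong (+-cong (*-congˡ q) (*-congʳ (sym b≈))) (+-congˡ (*-congʳ (sym d≈)))) ⟩
    a * e + b * g + (c * f + d * h) + κ * κ′ ∎
    where
    a′≈ : a′ ≈ a + κ
    a′≈ = trans r₁₂ (sym p)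
    b≈ : b ≈ b′ + κ
    b≈ = cancel {a} (begin
      a + b          ≈⟨ r₁₁ ⟨
      a′ + b′        ≈⟨ +-congʳ a′≈ ⟩
      a + κ + b′     ≈⟨ solve 3 (λ a k b → a :+ k :+ b := a :+ (b :+ k)) refl a κ b′ ⟩
      a + (b′ + κ)   ∎)
    d≈ : d ≈ d′ + κ
    d≈ = cancel {c} (begin
      c + d          ≈⟨ p ⟨
      a + κ          ≈⟨ +-congʳ r₂₁ ⟨
      c′ + d′ + κ    ≈⟨ +-congʳ (+-congʳ r₂₂) ⟩
      c + d′ + κ     ≈⟨ +-assoc c d′ κ ⟩
      c + (d′ + κ)   ∎)

open import Defs
import Algebra.Construct.Pointwise as Pointwise
import Algebra.Solver.Ring.NaturalCoefficients.Default as NaturalCoefficients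
import Algebra.Structures.Biased as Biased
open import Data.Bool.Base using (Bool; true; false; if_then_else_)
import Data.Bool.Properties as Bool
open import Data.Empty using (⊥)
open import Data.Fin.Base as Fin using (Fin; toℕ; fromℕ<)
import Data.Fin.Properties as Fin
open import Data.Integer.Base as ℤ using (ℤ; 0ℤ)
import Data.Integer.Properties as ℤ
open import Data.List.Base as List using (List; []; _∷_; _++_; map; concat; length; filter; allFin; applyUpTo)
import Data.List.Properties as List
open import Data.List.Relation.Unary.All as All using (All; []; _∷_; all?)
import Data.List.Relation.Unary.All.Properties as All
open import Data.List.Relation.Unary.AllPairs as AllPairs using (AllPairs; []; _∷_)
import Data.List.Relation.Unary.AllPairs.Properties as AllPairs
import Data.List.Relation.Unary.Unique.Propositional.Properties as Unique
open import Data.Nat.Base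
open import Data.Nat.DivMod
open import Data.Nat.Divisibility using (n∣m*n)
open import Data.Nat.Properties
open import Algebra.Properties.CommutativeSemigroup +-commutativeSemigroup using (interchange)
open import Data.Nat.Tactic.RingSolver using (solve-∀)
open import Data.Product.Base using (∃; _×_; _,_; proj₁; proj₂)
open import Data.Sum.Base using (_⊎_; inj₁; inj₂; [_,_]′)
open import Data.Unit.Base using (⊤; tt)
open import Data.Vec.Base as Vec using (lookup; tabulate)
import Data.Vec.Properties as Vec
open import Function.Base using (_∘_; id; case_of_)
open import Function.Bundles using (_⇔_; mk⇔; Equivalence)
open import Level using (0ℓ)
open import Relation.Binary.PropositionalEquality hiding ([_])
import Relation.Binary.Reasoning.Setoid as SetoidReasoning
open import Relation.Nullary
open import Relation.Nullary.Decidable as Dec using (does-≡; dec-true; dec-false)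
open import Relation.Unary using () renaming (Decidable to Decidable₁)

open Equivalence using (to; from)

-- Power series over ℕ

Series : Set
Series = ℕ → ℕ

infixl 6 _⊕_
infixl 7 _⊛_

_⊕_ : Series → Series → Series
(f ⊕ g) n = f n + g n

_⊛_ : Series → Series → Series
(f ⊛ g) zero    = f 0 * g 0
(f ⊛ g) (suc n) = f 0 * g (suc n) + ((f ∘ suc) ⊛ g) n

0ˢ 1ˢ X : Series
0ˢ _ = 0
1ˢ zero    = 1
1ˢ (suc _) = 0
X zero    = 0
X (suc n) = 1ˢ n

shift : Series → Series
shift f zero    = 0
shift f (suc n) = f n

shift-cong : ∀ {f g} → f ≗ g → shift f ≗ shift g
shift-cong eq zero    = refl
shift-cong eq (suc n) = eq n

⊛-cong : ∀ {f f′ g g′} → f ≗ f′ → g ≗ g′ → f ⊛ g ≗ f′ ⊛ g′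
⊛-cong p q zero    = cong₂ _*_ (p 0) (q 0)
⊛-cong p q (suc n) = cong₂ _+_ (cong₂ _*_ (p 0) (q (suc n))) (⊛-cong (p ∘ suc) q n)

⊛-distribʳ : ∀ h f g → (f ⊕ g) ⊛ h ≗ f ⊛ h ⊕ g ⊛ h
⊛-distribʳ h f g zero    = *-distribʳ-+ (h 0) (f 0) (g 0)
⊛-distribʳ h f g (suc n) = trans
  (cong₂ _+_ (*-distribʳ-+ (h (suc n)) (f 0) (g 0)) (⊛-distribʳ h (f ∘ suc) (g ∘ suc) n))
  (interchange (f 0 * h (suc n)) (g 0 * h (suc n)) (((f ∘ suc) ⊛ h) n) (((g ∘ suc) ⊛ h) n))

⊛-zeroˡ : ∀ g → 0ˢ ⊛ g ≗ 0ˢ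
⊛-zeroˡ g zero    = refl
⊛-zeroˡ g (suc n) = ⊛-zeroˡ g n

⊛-identityˡ : ∀ g → 1ˢ ⊛ g ≗ g
⊛-identityˡ g zero    = *-identityˡ (g 0)
⊛-identityˡ g (suc n) = trans (cong₂ _+_ (*-identityˡ (g (suc n))) (⊛-zeroˡ g n))
    (+-identityʳ (g (suc n)))

-- The product is defined by splitting off the constant term of its left factor; commutativity needs
-- this mirrored recursion.
⊛-tailʳ : ∀ f g n → (f ⊛ g) (suc n) ≡ (f ⊛ (g ∘ suc)) n + f (suc n) * g 0
⊛-tailʳ f g zero    = refl
⊛-tailʳ f g (suc n) = trans
  (cong (f 0 * g (suc (suc n)) +_) (⊛-tailʳ (f ∘ suc) g n))
  (sym (+-assoc (f 0 * g (suc (suc n))) _ _))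

⊛-comm : ∀ f g → f ⊛ g ≗ g ⊛ f
⊛-comm f g zero    = *-comm (f 0) (g 0)
⊛-comm f g (suc n) = begin
  f 0 * g (suc n) + ((f ∘ suc) ⊛ g) n  ≡⟨ cong₂ _+_ (*-comm (f 0) (g (suc n))) (⊛-comm (f ∘ suc) g n) ⟩
  g (suc n) * f 0 + (g ⊛ (f ∘ suc)) n  ≡⟨ +-comm (g (suc n) * f 0) _ ⟩
  (g ⊛ (f ∘ suc)) n + g (suc n) * f 0  ≡⟨ ⊛-tailʳ g f n ⟨
  (g ⊛ f) (suc n)                      ∎
  where open ≡-Reasoning

⊛-scaleˡ : ∀ k f g n → ((λ i → k * f i) ⊛ g) n ≡ k * (f ⊛ g) n
⊛-scaleˡ k f g zero    = *-assoc k (f 0) (g 0)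
⊛-scaleˡ k f g (suc n) = trans
  (cong₂ _+_ (*-assoc k (f 0) (g (suc n))) (⊛-scaleˡ k (f ∘ suc) g n))
  (sym (*-distribˡ-+ k (f 0 * g (suc n)) _))

⊛-assoc : ∀ f g h → (f ⊛ g) ⊛ h ≗ f ⊛ (g ⊛ h)
⊛-assoc f g h zero    = *-assoc (f 0) (g 0) (h 0)
⊛-assoc f g h (suc n) = begin
  f 0 * g 0 * h (suc n) + ((λ i → f 0 * g (suc i) + ((f ∘ suc) ⊛ g) i) ⊛ h) n
    ≡⟨ cong₂ _+_ (*-assoc (f 0) (g 0) (h (suc n)))
        (⊛-distribʳ h (λ i → f 0 * g (suc i)) ((f ∘ suc) ⊛ g) n) ⟩
  f 0 * (g 0 * h (suc n)) + (((λ i → f 0 * g (suc i)) ⊛ h) n + (((f ∘ suc) ⊛ g) ⊛ h) n)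
    ≡⟨ cong (f 0 * (g 0 * h (suc n)) +_)
        (cong₂ _+_ (⊛-scaleˡ (f 0) (g ∘ suc) h n) (⊛-assoc (f ∘ suc) g h n)) ⟩
  f 0 * (g 0 * h (suc n)) + (f 0 * ((g ∘ suc) ⊛ h) n + ((f ∘ suc) ⊛ (g ⊛ h)) n)
    ≡⟨ +-assoc (f 0 * (g 0 * h (suc n))) _ _ ⟨
  f 0 * (g 0 * h (suc n)) + f 0 * ((g ∘ suc) ⊛ h) n + ((f ∘ suc) ⊛ (g ⊛ h)) n
    ≡⟨ cong (_+ ((f ∘ suc) ⊛ (g ⊛ h)) n) (*-distribˡ-+ (f 0) (g 0 * h (suc n)) _) ⟨
  f 0 * (g ⊛ h) (suc n) + ((f ∘ suc) ⊛ (g ⊛ h)) n ∎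
  where open ≡-Reasoning

seriesSemiring : CommutativeSemiring 0ℓ 0ℓ
seriesSemiring = record
  { Carrier = Series ; _≈_ = _≗_ ; _+_ = _⊕_ ; _*_ = _⊛_ ; 0# = 0ˢ ; 1# = 1ˢ
  ; isCommutativeSemiring = Biased.isCommutativeSemiringˡ record
    { +-isCommutativeMonoid = Pointwise.isCommutativeMonoid ℕ +-0-isCommutativeMonoid
    ; *-isCommutativeMonoid = Biased.isCommutativeMonoidˡ record
      { isSemigroup = record
        { isMagma = record
          { isEquivalence = Pointwise.isEquivalence ℕ isEquivalence
          ; ∙-cong        = ⊛-cong
          }
        ; assoc = ⊛-assoc
        }
      ; identityˡ = ⊛-identityˡ
      ; comm      = ⊛-comm
      }
    ; distribʳ = ⊛-distribʳ
    ; zeroˡ    = ⊛-zeroˡ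
    }
  }

X⊛ : ∀ f → X ⊛ f ≗ shift f
X⊛ f zero    = refl
X⊛ f (suc n) = ⊛-identityˡ f n

PositiveUpTo : ℕ → Series → Set
PositiveUpTo d f = ∀ j → j ≤ d → 0 < f j

positive-mono : ∀ {d f g} → (∀ j → f j ≤ g j) → PositiveUpTo d f → PositiveUpTo d g
positive-mono f≤g p j j≤d = <-≤-trans (p j j≤d) (f≤g j)

-- For j ≤ d + e the summand f(i) g(j - i) with i = min(d, j) has both factors positive.
positive-⊛ : ∀ {d e f g} → PositiveUpTo d f → PositiveUpTo e g → PositiveUpTo (d + e) (f ⊛ g)
positive-⊛ {d} {e} {f} {g} p q zero _ = *-mono-< {0} {f 0} {0} {g 0} (p 0 z≤n) (q 0 z≤n)
positive-⊛ {zero} {e} {f} {g} p q (suc j) j≤ =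
  <-≤-trans (*-mono-< {0} {f 0} {0} (p 0 z≤n) (q (suc j) j≤)) (m≤m+n _ _)
positive-⊛ {suc d} {e} {f} {g} p q (suc j) (s≤s j≤) =
  <-≤-trans (positive-⊛ {d} {e} {f ∘ suc} {g} (λ i i≤d → p (suc i) (s≤s i≤d)) q j j≤) (m≤n+m _ _)

infixr 8 X^_

X^_ : ℕ → Series
X^ zero  = 1ˢ
X^ suc k = X ⊛ X^ k

X^-low : ∀ k f j → j < k → (X^ k ⊛ f) j ≡ 0
X^-low (suc k) f zero    _         = trans (⊛-assoc X (X^ k) f 0) refl
X^-low (suc k) f (suc j) (s≤s j<k) =
  trans (⊛-assoc X (X^ k) f (suc j)) (trans (X⊛ (X^ k ⊛ f) (suc j)) (X^-low k f j j<k))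

X^-high : ∀ k f j → (X^ k ⊛ f) (k + j) ≡ f j
X^-high zero    f j = ⊛-identityˡ f j
X^-high (suc k) f j =
  trans (⊛-assoc X (X^ k) f (suc (k + j))) (trans (X⊛ (X^ k ⊛ f) (suc (k + j))) (X^-high k f j))

positive-suc : ∀ {d f g} → PositiveUpTo d f → PositiveUpTo d g → PositiveUpTo (suc d) (f ⊕ X ⊛ g)
positive-suc {f = f} p q zero    _         = <-≤-trans (p 0 z≤n) (m≤m+n (f 0) _)
positive-suc {f = f} {g} p q (suc j) (s≤s j≤d) =
  <-≤-trans (subst (0 <_) (sym (X⊛ g (suc j))) (q j j≤d)) (m≤n+m _ (f (suc j)))

open Matrices seriesSemiring
open Letters X
open NaturalCoefficients seriesSemiring using (solve; con; _:=_; _:+_; _:*_)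

module S = CommutativeSemiring seriesSemiring

-- Products of transfer matrices

module Products (q′ : ℕ) where

  -- With q′ = q − 2: choosing in K_{q+c} nothing or a vertex other than x, y.
  weight : ℕ → Series
  weight c = 1ˢ ⊕ (λ n → (q′ + c) * X n)

  letter : ℕ → Mat
  letter c = T (weight c)

  weight-1 : weight 1 ≗ weight 0 ⊕ X
  weight-1 n = begin
    1ˢ n + (q′ + 1) * X n        ≡⟨ cong (λ k → 1ˢ n + k * X n) (+-comm q′ 1) ⟩
    1ˢ n + (X n + q′ * X n)      ≡⟨ cong (1ˢ n +_) (+-comm (X n) (q′ * X n)) ⟩
    1ˢ n + (q′ * X n + X n)      ≡⟨ cong (λ k → 1ˢ n + (k * X n + X n)) (+-identityʳ q′) ⟨
    1ˢ n + ((q′ + 0) * X n + X n) ≡⟨ +-assoc (1ˢ n) _ (X n) ⟨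
    1ˢ n + (q′ + 0) * X n + X n ∎
    where open ≡-Reasoning

  -- This is the form in which the scan of a clique meets the weight: one of the `q′ + c` vertices
  -- without links, or none.
  weight⊛ : ∀ c f → weight c ⊛ f ≗ (λ n → (q′ + c) * shift f n) ⊕ f
  weight⊛ c f n = begin
    (weight c ⊛ f) n                             ≡⟨ ⊛-distribʳ f 1ˢ (λ n → (q′ + c) * X n) n ⟩
    (1ˢ ⊛ f) n + ((λ n → (q′ + c) * X n) ⊛ f) n
      ≡⟨ cong₂ _+_ (⊛-identityˡ f n) (⊛-scaleˡ (q′ + c) X f n) ⟩
    f n + (q′ + c) * (X ⊛ f) n                   ≡⟨ cong (λ k → f n + (q′ + c) * k) (X⊛ f n) ⟩
    f n + (q′ + c) * shift f n                   ≡⟨ +-comm (f n) _ ⟩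
    (q′ + c) * shift f n + f n                   ∎
    where open ≡-Reasoning

  ≤-weight⊛ : ∀ c f n → f n ≤ (weight c ⊛ f) n
  ≤-weight⊛ c f n = ≤-trans (m≤n+m (f n) _) (≤-reflexive (sym (weight⊛ c f n)))

  -- Sequences on ℕ with an offset, so that a factor of the periodic extension needs no wrap-around.
  prod revprod : (ℕ → ℕ) → ℕ → ℕ → Mat
  prod f i zero    = Id
  prod f i (suc n) = letter (f i) · prod f (suc i) n
  revprod f i zero    = Id
  revprod f i (suc n) = revprod f (suc i) n · letter (f i)

  prod-cong : ∀ {f g i j} n → (∀ k → k < n → f (i + k) ≡ g (j + k)) → prod f i n ≡ prod g j n
  prod-cong zero eq = refl
  prod-cong {f} {g} {i} {j} (suc n) eq = cong₂ (λ c M → letter c · M)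
    (subst₂ (λ a b → f a ≡ g b) (+-identityʳ i) (+-identityʳ j) (eq 0 z<s))
    (prod-cong n λ k k<n → subst₂ (λ a b → f a ≡ g b) (+-suc i k) (+-suc j k) (eq (suc k) (s<s k<n)))

  prod-+ : ∀ f i m n → prod f i (m + n) ≋ prod f i m · prod f (i + m) n
  prod-+ f i zero n rewrite +-identityʳ i = ≋-sym (·-identityˡ _)
  prod-+ f i (suc m) n rewrite +-suc i m =
    ≋-trans (·-cong ≋-refl (prod-+ f (suc i) m n)) (≋-sym (·-assoc (letter (f i)) _ _))

  prod-∷ʳ : ∀ f i n → prod f i (suc n) ≋ prod f i n · letter (f (i + n))
  prod-∷ʳ f i n = subst (λ k → prod f i k ≋ prod f i n · letter (f (i + n))) (+-comm n 1)
    (≋-trans (prod-+ f i n 1) (·-cong ≋-refl (·-identityʳ _)))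

  reversal-prod : ∀ f i n → Reversal (prod f i n) (revprod f i n)
  reversal-prod f i zero    = reversal-Id
  reversal-prod f i (suc n) = reversal-· (reversal-T (weight (f i))) (reversal-prod f (suc i) n)

  revprod-prod : ∀ {f g} i j n → (∀ k l → suc (k + l) ≡ n → g (j + k) ≡ f (i + l)) →
    prod g j n ≋ revprod f i n
  revprod-prod i j zero eq = ≋-refl
  revprod-prod {f} {g} i j (suc n) eq = ≋-trans (prod-∷ʳ g j n) (·-cong
    (revprod-prod (suc i) j n λ k l kl → trans (eq k (suc l) (cong suc (trans (+-suc k l) kl)))
        (cong f (+-suc i l)))
    (subst (λ c → letter (g (j + n)) ≋ letter c)
        (trans (eq n 0 (cong suc (+-identityʳ n))) (cong f (+-identityʳ i))) ≋-refl))

  -- Each letter multiplies the upper left entry by at least 1 + x, because the weight is at least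
  -- 1.
  positive-e₁₁ : ∀ f i n → PositiveUpTo n (e₁₁ (prod f i n))
  positive-e₁₁ f i zero    zero _ = z<s
  positive-e₁₁ f i (suc n) = positive-mono bound (positive-suc p p)
    where
    M = prod f (suc i) n
    p = positive-e₁₁ f (suc i) n
    bound : ∀ j → (e₁₁ M ⊕ X ⊛ e₁₁ M) j ≤ e₁₁ (letter (f i) · M) j
    bound j = begin
      e₁₁ M j + (X ⊛ e₁₁ M) j                       ≤⟨ +-monoˡ-≤ _ (≤-weight⊛ (f i) (e₁₁ M) j) ⟩
      (weight (f i) ⊛ e₁₁ M) j + (X ⊛ e₁₁ M) j      ≡⟨ ⊛-distribʳ (e₁₁ M) (weight (f i)) X j ⟨
      ((weight (f i) ⊕ X) ⊛ e₁₁ M) j                ≤⟨ m≤m+n _ _ ⟩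
      e₁₁ (letter (f i) · M) j                      ∎
      where open ≤-Reasoning

  -- The constant term comes from the upper left entry of the remaining product, the higher
  -- coefficients from x times its second row.
  positive-row₂ : ∀ f i n → PositiveUpTo n (e₂₁ (prod f i n) ⊕ e₂₂ (prod f i n))
  positive-row₂ f i zero    zero _ = z<s
  positive-row₂ f i (suc n) = positive-mono bound
      (positive-suc (positive-e₁₁ f (suc i) n) (positive-row₂ f (suc i) n))
    where
    M = prod f (suc i) n
    s = weight (f i)
    bound : ∀ j → (e₁₁ M ⊕ X ⊛ (e₂₁ M ⊕ e₂₂ M)) j ≤ (e₂₁ (letter (f i) · M) ⊕ e₂₂ (letter (f i) · M)) j
    bound j = begin
      e₁₁ M j + (X ⊛ (e₂₁ M ⊕ e₂₂ M)) j
        ≤⟨ +-monoˡ-≤ _ (≤-weight⊛ (f i) (e₁₁ M) j) ⟩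
      (s ⊛ e₁₁ M ⊕ X ⊛ (e₂₁ M ⊕ e₂₂ M)) j                      ≤⟨ m≤m+n _ _ ⟩
      (s ⊛ e₁₁ M ⊕ X ⊛ (e₂₁ M ⊕ e₂₂ M) ⊕ s ⊛ e₁₂ M) j
        ≡⟨ solve 6 (λ s x a b c d → s :* a :+ x :* (c :+ d) :+ s :* b := (s :* a :+ x :* c) :+
            (s :* b :+ x :* d))
                   S.refl s X (e₁₁ M) (e₁₂ M) (e₂₁ M) (e₂₂ M) j ⟩
      (e₂₁ (letter (f i) · M) ⊕ e₂₂ (letter (f i) · M)) j      ∎
      where open ≤-Reasoning

  -- Positions k and l of the block mirror each other when k + l + 1 is its length. The first and
  -- the last letter agree, so `sandwich` peels them off for a factor x², and this happens m times.
  palindromic-sandwich : ∀ f i m n κ →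
    (∀ k l → k < m → suc (k + l) ≡ m + n + m → f (i + k) ≡ f (i + l)) →
    let Q = prod f (i + m) n ; N = prod f i (m + n + m) in
    e₁₁ Q ⊕ κ ≗ e₂₁ Q ⊕ e₂₂ Q → e₁₁ N ⊕ X^ (m * 2) ⊛ κ ≗ e₂₁ N ⊕ e₂₂ N
  palindromic-sandwich f i zero n κ pal eq
    rewrite +-identityʳ i | +-identityʳ n = S.trans (S.+-congˡ {e₁₁ (prod f i n)} (⊛-identityˡ κ)) eq
  palindromic-sandwich f i (suc m) n κ pal eq rewrite +-suc (m + n) m = begin
    e₁₁ N ⊕ X^ (suc m * 2) ⊛ κ
      ≈⟨ S.+-cong (≈₁₁ N≋) (solve 3 (λ x p κ → (x :* (x :* p)) :* κ := x :* (x :* (p :* κ))) S.refl X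
          (X^ (m * 2)) κ) ⟩
    e₁₁ N′ ⊕ X ⊛ (X ⊛ (X^ (m * 2) ⊛ κ))      ≈⟨ sandwich (weight (f i)) M _ ih ⟩
    e₂₁ N′ ⊕ e₂₂ N′                          ≈⟨ S.+-cong (≈₂₁ N≋) (≈₂₂ N≋) ⟨
    e₂₁ N ⊕ e₂₂ N                            ∎
    where
    open SetoidReasoning S.setoid
    len = m + n + m
    N  = prod f i (suc (suc len))
    M  = prod f (suc i) len
    N′ = letter (f i) · M · letter (f i)
    ends : f (suc i + len) ≡ f i
    ends = sym (trans (cong f (sym (+-identityʳ i)))
        (trans (pal 0 (suc len) z<s refl) (cong f (+-suc i len))))
    N≋ : N ≋ N′
    N≋ = ≋-trans (·-cong ≋-refl (subst (λ c → prod f (suc i) (suc len) ≋ M · letter c) ends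
        (prod-∷ʳ f (suc i) len)))
                 (≋-sym (·-assoc (letter (f i)) M (letter (f i))))
    ih : e₁₁ M ⊕ X^ (m * 2) ⊛ κ ≗ e₂₁ M ⊕ e₂₂ M
    ih = palindromic-sandwich f (suc i) m n κ
      (λ k l k<m kl → subst₂ (λ a b → f a ≡ f b) (+-suc i k) (+-suc i l)
         (pal (suc k) (suc l) (s<s k<m) (cong (suc ∘ suc) (trans (+-suc k l) kl))))
      (subst (λ a → e₁₁ (prod f a n) ⊕ κ ≗ e₂₁ (prod f a n) ⊕ e₂₂ (prod f a n)) (+-suc i m) eq)

  core-letters : ∀ M → let Q = letter 1 · M · letter 0 in
    e₁₁ Q ⊕ X ⊛ (X ⊛ (e₁₂ M ⊕ (e₂₁ M ⊕ e₂₂ M))) ≗ e₂₁ Q ⊕ e₂₂ Q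
  core-letters M = begin
    e₁₁ Q ⊕ κ          ≈⟨ S.+-congʳ (≈₁₁ Q≋) ⟩
    e₁₁ Q′ ⊕ κ         ≈⟨ core (weight 0) M ⟩
    e₂₁ Q′ ⊕ e₂₂ Q′    ≈⟨ S.+-cong (≈₂₁ Q≋) (≈₂₂ Q≋) ⟨
    e₂₁ Q ⊕ e₂₂ Q      ∎
    where
    open SetoidReasoning S.setoid
    Q  = letter 1 · M · letter 0
    Q′ = T (weight 0 ⊕ X) · M · letter 0
    κ  = X ⊛ (X ⊛ (e₁₂ M ⊕ (e₂₁ M ⊕ e₂₂ M)))
    Q≋ : Q ≋ Q′
    Q≋ = ·-cong (·-cong {letter 1} (mat≋ (S.+-congʳ weight-1) S.refl weight-1 S.refl) (≋-refl {M}))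
        (≋-refl {letter 0})

  -- Up to the factor x², the antisymmetric part that `core` finds for a block with outer letters 1
  -- and 0.
  corner : Mat → Series
  corner M = e₁₂ M ⊕ (e₂₁ M ⊕ e₂₂ M)

  positive-corner : ∀ {n} M → PositiveUpTo n (e₂₁ M ⊕ e₂₂ M) → PositiveUpTo n (corner M)
  positive-corner M = positive-mono λ j → m≤n+m _ (e₁₂ M j)

  tr-prod-rotate : ∀ f i n → f (i + suc n) ≡ f i → tr (prod f (suc i) (suc n)) ≗ tr (prod f i (suc n))
  tr-prod-rotate f i n eq = begin
    tr (prod f (suc i) (suc n))                        ≈⟨ tr-cong (prod-∷ʳ f (suc i) n) ⟩
    tr (prod f (suc i) n · letter (f (suc i + n)))
      ≈⟨ tr-comm (prod f (suc i) n) (letter (f (suc i + n))) ⟩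
    tr (letter (f (suc i + n)) · prod f (suc i) n)
      ≡⟨ cong (λ c → tr (letter c · prod f (suc i) n)) (trans (cong f (sym (+-suc i n))) eq) ⟩
    tr (prod f i (suc n))                              ∎
    where open SetoidReasoning S.setoid

  -- f = 1p1X0p0Y and g = 1p0X̃1p0Y with |p| = m, |X| = a and |Y| = b; the second
  -- block 0p0 of f occupies the positions d to e.
  record Swap (f g : ℕ → ℕ) (m a b d e : ℕ) : Set where
    field
      d≡        : d ≡ suc (suc m) + a
      e≡        : e ≡ suc (d + m)
      f[0]      : f 0 ≡ 1
      f[m+1]    : f (suc m) ≡ 1
      f[d]      : f d ≡ 0
      f[e]      : f e ≡ 0
      mirror    : ∀ k l → k < m → suc k + l ≡ e → f (suc k) ≡ f l
      g[0]      : g 0 ≡ f 0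
      reflected : ∀ k l → suc k + suc l ≡ e → g (suc k) ≡ f (suc l)
      unchanged : ∀ k → k < suc b → g (e + k) ≡ f (e + k)

  -- Moving the leading 1 behind Y (`split`) makes the cyclic word p1X0p followed by 0Y1, and only
  -- the first of these blocks is reversed. The exponent collects x² for each of the m letters of p,
  -- x² from 1X0 and x² from 0Y1.
  tr-swap : ∀ {f g m a b d e} → Swap f g m a b d e →
    ∃ λ h → PositiveUpTo (a + b) h ×
      tr (prod g 0 (e + suc b)) ≗ tr (prod f 0 (e + suc b)) ⊕ X^ ((2 + m) * 2) ⊛ h
  tr-swap {f} {g} {m} {a} {b} {d} {e} record
    { d≡ = refl ; e≡ = refl ; f[0] = f[0] ; f[m+1] = f[m+1] ; f[d] = f[d] ; f[e] = f[e]
    ; mirror = mirror ; g[0] = g[0] ; reflected = reflected ; unchanged = unchanged } =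
    F ⊛ G ,
    positive-⊛ {f = F} {G} (positive-corner M (positive-row₂ f (2 + m) a)) positive-G ,
    (begin
      tr (prod g 0 (e + suc b))                  ≈⟨ split g ⟩
      tr (prod g 1 e′ · (prod g e (suc b) · letter (g 0)))
        ≡⟨ cong₂ (λ R c → tr (prod g 1 e′ · (R · letter c))) (prod-cong (suc b) unchanged) g[0] ⟩
      tr (prod g 1 e′ · Z)
        ≈⟨ tr-cong (·-cong (revprod-prod 1 1 e′
            (λ k l kl → reflected k l (cong suc (trans (+-suc k l) kl)))) ≋-refl) ⟩
      tr (revprod f 1 e′ · Z)
        ≈⟨ tr-reversal Z κ κ′ (reversal-prod f 1 e′)
            (λ {u} p n → +-cancelˡ-≡ (u n) _ _ (p n)) inner outer ⟩
      tr (prod f 1 e′ · Z) ⊕ κ ⊛ κ′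
        ≈⟨ S.+-cong (S.sym (split f)) (solve 4
            (λ x p u v → (p :* (x :* (x :* u))) :* (x :* (x :* v)) :=
                (x :* (x :* (x :* (x :* p)))) :* (u :* v)) S.refl X (X^ (m * 2)) F G) ⟩
      tr (prod f 0 (e + suc b)) ⊕ X^ ((2 + m) * 2) ⊛ (F ⊛ G) ∎)
    where
    open SetoidReasoning S.setoid
    e′ = d + m
    M = prod f (2 + m) a
    F = corner M
    -- `Y` is the reversed product because 0Y1 read backwards has the outer letters 1 and 0 in the
    -- order that `core` treats.
    Y = revprod f (suc e) b
    G = corner Y
    κ  = X^ (m * 2) ⊛ (X ⊛ (X ⊛ F))
    κ′ = X ⊛ (X ⊛ G)
    Z = prod f e (suc b) · letter (f 0)

    positive-G : PositiveUpTo b G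
    positive-G = positive-corner Y (positive-mono
      (λ j → ≤-reflexive (sym (Reversal.r₂₁ (reversal-prod f (suc e) b) j))) (positive-e₁₁ f (suc e) b))

    split : ∀ h → tr (prod h 0 (e + suc b)) ≗ tr (prod h 1 e′ · (prod h e (suc b) · letter (h 0)))
    split h = begin
      tr (letter (h 0) · prod h 1 (e′ + suc b))
        ≈⟨ tr-cong (·-cong ≋-refl (prod-+ h 1 e′ (suc b))) ⟩
      tr (letter (h 0) · (prod h 1 e′ · prod h e (suc b)))
        ≈⟨ tr-comm (letter (h 0)) (prod h 1 e′ · prod h e (suc b)) ⟩
      tr (prod h 1 e′ · prod h e (suc b) · letter (h 0))     ≈⟨ tr-cong (·-assoc (prod h 1 e′) _ _) ⟩
      tr (prod h 1 e′ · (prod h e (suc b) · letter (h 0)))   ∎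

    e′≡ : e′ ≡ m + suc (suc a) + m
    e′≡ = cong (_+ m) (sym (trans (+-suc m (suc a)) (cong suc (+-suc m a))))

    inner : e₁₁ (prod f 1 e′) ⊕ κ ≗ e₂₁ (prod f 1 e′) ⊕ e₂₂ (prod f 1 e′)
    inner = subst (λ n → e₁₁ (prod f 1 n) ⊕ κ ≗ e₂₁ (prod f 1 n) ⊕ e₂₂ (prod f 1 n)) (sym e′≡)
      (palindromic-sandwich f 1 m (suc (suc a)) (X ⊛ (X ⊛ F))
        (λ k l k<m kl → mirror k (suc l) k<m (cong suc (trans (+-suc k l) (trans kl (sym e′≡)))))
        (begin
          e₁₁ Q ⊕ X ⊛ (X ⊛ F)    ≈⟨ S.+-congʳ (≈₁₁ Q≋) ⟩
          e₁₁ Q′ ⊕ X ⊛ (X ⊛ F)   ≈⟨ core-letters M ⟩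
          e₂₁ Q′ ⊕ e₂₂ Q′        ≈⟨ S.+-cong (≈₂₁ Q≋) (≈₂₂ Q≋) ⟨
          e₂₁ Q ⊕ e₂₂ Q          ∎))
      where
      Q  = prod f (suc m) (suc (suc a))
      Q′ = letter 1 · M · letter 0
      Q≋ : Q ≋ Q′
      Q≋ = ≋-trans (subst₂ (λ c c′ → Q ≋ letter c · (M · letter c′)) f[m+1] f[d]
                     (·-cong ≋-refl (prod-∷ʳ f (2 + m) a)))
                   (≋-sym (·-assoc (letter 1) M (letter 0)))

    -- Reversal transposes Z J, hence changes the sign of its antisymmetric part: this is the
    -- inequality for the reversed block with the two sides exchanged.
    outer : e₂₁ Z ⊕ e₂₂ Z ⊕ κ′ ≗ e₁₁ Z
    outer = begin
      e₂₁ Z ⊕ e₂₂ Z ⊕ κ′     ≈⟨ S.+-congʳ (Reversal.r₁₂ rev) ⟨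
      e₁₁ Z′ ⊕ κ′            ≈⟨ core-letters Y ⟩
      e₂₁ Z′ ⊕ e₂₂ Z′        ≈⟨ Reversal.r₂₁ rev ⟩
      e₁₁ Z                  ∎
      where
      Z′ = letter 1 · Y · letter 0
      Z≋ : letter (f 0) · revprod f e (suc b) ≋ Z′
      Z≋ = subst₂ (λ c c′ → letter (f 0) · revprod f e (suc b) ≋ letter c · Y · letter c′) f[0] f[e]
             (≋-sym (·-assoc (letter (f 0)) Y (letter (f e))))
      rev : Reversal Z Z′
      rev = reversal-respʳ Z≋ (reversal-· (reversal-prod f e (suc b)) (reversal-T (weight (f 0))))

-- Numbers of ones in factors

toℕ-mod : ∀ k n .{{_ : NonZero n}} → toℕ (k mod n) ≡ k % n
toℕ-mod k n = Fin.toℕ-fromℕ< (m%n<n k n)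

mod-cong : ∀ {k l n} .{{_ : NonZero n}} → k % n ≡ l % n → k mod n ≡ l mod n
mod-cong {k} {l} {n} eq = Fin.toℕ-injective (trans (toℕ-mod k n) (trans eq (sym (toℕ-mod l n))))

win : (ℕ → ℕ) → ℕ → ℕ → ℕ
win f i zero    = 0
win f i (suc n) = f i + win f (suc i) n

win-cong : ∀ {f g i j} n → (∀ k → k < n → f (i + k) ≡ g (j + k)) → win f i n ≡ win g j n
win-cong zero eq = refl
win-cong {f} {g} {i} {j} (suc n) eq = cong₂ _+_
  (subst₂ (λ a b → f a ≡ g b) (+-identityʳ i) (+-identityʳ j) (eq 0 z<s))
  (win-cong n λ k k<n → subst₂ (λ a b → f a ≡ g b) (+-suc i k) (+-suc j k) (eq (suc k) (s<s k<n)))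

win-+ : ∀ f i m n → win f i (m + n) ≡ win f i m + win f (i + m) n
win-+ f i zero n rewrite +-identityʳ i = refl
win-+ f i (suc m) n rewrite +-suc i m =
  trans (cong (f i +_) (win-+ f (suc i) m n)) (sym (+-assoc (f i) _ _))

win-∷ʳ : ∀ f i n → win f i (suc n) ≡ win f i n + f (i + n)
win-∷ʳ f i n = trans (cong (win f i) (sym (+-comm n 1)))
  (trans (win-+ f i n 1) (cong (win f i n +_) (+-identityʳ _)))

win-reverse : ∀ {f g} i j n → (∀ k l → suc (k + l) ≡ n → g (j + k) ≡ f (i + l)) → win g j n ≡ win f i n
win-reverse i j zero eq = refl
win-reverse {f} {g} i j (suc n) eq = trans (win-∷ʳ g j n) (trans (+-comm _ (g (j + n))) (cong₂ _+_
  (trans (eq n 0 (cong suc (+-identityʳ n))) (cong f (+-identityʳ i)))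
  (win-reverse (suc i) j n λ k l kl →
    trans (eq k (suc l) (cong suc (trans (+-suc k l) kl))) (cong f (+-suc i l)))))

ones-tabulate : ∀ {n} (h : Fin n → Fin 2) f i → (∀ k → toℕ (h k) ≡ f (i + toℕ k)) →
  ones (tabulate h) ≡ win f i n
ones-tabulate {zero} h f i eq = refl
ones-tabulate {suc n} h f i eq = cong₂ _+_ (trans (eq Fin.zero) (cong f (+-identityʳ i)))
  (ones-tabulate (h ∘ Fin.suc) f (suc i) λ k → trans (eq (Fin.suc k)) (cong f (+-suc i (toℕ k))))

module _ {α : ℕ} .{{_ : NonZero α}} where

  ext : Word α → ℕ → ℕ
  ext w k = toℕ (lookup w (k mod α))

  ext-cong : ∀ w {k l} → k % α ≡ l % α → ext w k ≡ ext w l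
  ext-cong w eq = cong (toℕ ∘ lookup w) (mod-cong eq)

  ext-periodic : ∀ w k → ext w (k + α) ≡ ext w k
  ext-periodic w k = ext-cong w ([m+n]%n≡m%n k α)

  ext≤1 : ∀ w k → ext w k ≤ 1
  ext≤1 w k = s≤s⁻¹ (Fin.toℕ<n {2} (lookup w (k mod α)))

  ext-toℕ : ∀ (w : Word α) (k : Fin α) → lookup w k ≡ lookup w (toℕ k mod α)
  ext-toℕ w k = cong (lookup w) (Fin.toℕ-injective
      (sym (trans (toℕ-mod (toℕ k) α) (m<n⇒m%n≡m (Fin.toℕ<n k)))))

  ones-factor : ∀ w i r → ones (factor w i r) ≡ win (ext w) i r
  ones-factor w i r = ones-tabulate {r} (λ k → lookup w ((i + toℕ k) mod α)) (ext w) i λ _ → refl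

  ones-win : ∀ w → ones w ≡ win (ext w) 0 α
  ones-win w = trans (cong ones (sym (Vec.tabulate∘lookup w)))
    (ones-tabulate (lookup w) (ext w) 0 λ k → cong (toℕ {2}) (ext-toℕ w k))

  ext-tabulate : ∀ (h : ℕ → Fin 2) {k} → k < α → ext (tabulate (h ∘ toℕ)) k ≡ toℕ (h k)
  ext-tabulate h {k} k<α = cong toℕ (trans (Vec.lookup∘tabulate (h ∘ toℕ) (k mod α))
    (cong h (trans (toℕ-mod k α) (m<n⇒m%n≡m k<α))))

  ext-factor : ∀ w i k → ext (factor w i α) k ≡ ext w (i + k)
  ext-factor w i k = trans
    (cong toℕ (Vec.lookup∘tabulate (λ k → lookup w ((i + toℕ k) mod α)) (k mod α)))
    (ext-cong w (trans (cong (λ l → (i + l) % α) (toℕ-mod k α)) (begin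
      (i + k % α) % α              ≡⟨ %-distribˡ-+ i (k % α) α ⟩
      (i % α + k % α % α) % α      ≡⟨ cong (λ l → (i % α + l) % α) (m%n%n≡m%n k α) ⟩
      (i % α + k % α) % α          ≡⟨ %-distribˡ-+ i k α ⟨
      (i + k) % α                  ∎)))
    where open ≡-Reasoning

  win-factor : ∀ w i j n → win (ext (factor w i α)) j n ≡ win (ext w) (i + j) n
  win-factor w i j n = win-cong n λ k _ → trans (ext-factor w i (j + k))
      (cong (ext w) (sym (+-assoc i j k)))

  win-periodic : ∀ w i n → win (ext w) (i + α) n ≡ win (ext w) i n
  win-periodic w i n = win-cong n λ k _ → ext-cong w (begin
    (i + α + k) % α
      ≡⟨ cong (_% α) (trans (+-assoc i α k) (trans (cong (i +_) (+-comm α k)) (sym (+-assoc i k α)))) ⟩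
    (i + k + α) % α     ≡⟨ [m+n]%n≡m%n (i + k) α ⟩
    (i + k) % α         ∎)
    where open ≡-Reasoning

  win-period : ∀ w i → win (ext w) i α ≡ ones w
  win-period w zero    = sym (ones-win w)
  win-period w (suc i) = trans (+-cancelˡ-≡ (ext w i) _ _ (begin
    ext w i + win (ext w) (suc i) α    ≡⟨ win-∷ʳ (ext w) i α ⟩
    win (ext w) i α + ext w (i + α)    ≡⟨ cong (win (ext w) i α +_) (ext-periodic w i) ⟩
    win (ext w) i α + ext w i          ≡⟨ +-comm _ (ext w i) ⟩
    ext w i + win (ext w) i α          ∎)) (win-period w i)
    where open ≡-Reasoning

-- Balanced words

≤suc⇒∣-∣≤1 : ∀ {m n} → m ≤ suc n → n ≤ suc m → ∣ m - n ∣ ≤ 1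
≤suc⇒∣-∣≤1 {m} {n} m≤ n≤ with ≤-total m n
... | inj₁ m≤n = ≤-trans (≤-reflexive (m≤n⇒∣m-n∣≡n∸m m≤n))
    (m≤n+o⇒m∸n≤o n m (≤-trans n≤ (≤-reflexive (+-comm 1 m))))
... | inj₂ n≤m = ≤-trans (≤-reflexive (m≤n⇒∣n-m∣≡n∸m n≤m))
    (m≤n+o⇒m∸n≤o m n (≤-trans m≤ (≤-reflexive (+-comm 1 n))))

∣-∣≤1⇒≤suc : ∀ {m n} → ∣ m - n ∣ ≤ 1 → m ≤ suc n
∣-∣≤1⇒≤suc {m} {n} le = ≤-trans (m≤n+∣m-n∣ m n) (≤-trans (+-monoʳ-≤ n le) (≤-reflexive (+-comm n 1)))

m/o+n/o≤[m+n]/o : ∀ m n o .{{_ : NonZero o}} → m / o + n / o ≤ (m + n) / o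
m/o+n/o≤[m+n]/o m n o = begin
  m / o + n / o              ≡⟨ m*n/n≡m (m / o + n / o) o ⟨
  (m / o + n / o) * o / o
    ≤⟨ /-monoˡ-≤ o (≤-trans (≤-reflexive (*-distribʳ-+ o (m / o) (n / o)))
        (+-mono-≤ (m/n*n≤m m o) (m/n*n≤m n o))) ⟩
  (m + n) / o                ∎
  where open ≤-Reasoning

m<[1+m/n]*n : ∀ m n .{{_ : NonZero n}} → m < suc (m / n) * n
m<[1+m/n]*n m n = begin-strict
  m                       ≡⟨ m≡m%n+[m/n]*n m n ⟩
  m % n + m / n * n       <⟨ +-monoˡ-< (m / n * n) (m%n<n m n) ⟩
  suc (m / n) * n         ∎
  where open ≤-Reasoning

[m+n]/o≤1+m/o+n/o : ∀ m n o .{{_ : NonZero o}} → (m + n) / o ≤ suc (m / o + n / o)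
[m+n]/o≤1+m/o+n/o m n o = s≤s⁻¹ (m<n*o⇒m/o<n (begin-strict
  m + n                                      <⟨ +-mono-< (m<[1+m/n]*n m o) (m<[1+m/n]*n n o) ⟩
  suc (m / o) * o + suc (n / o) * o          ≡⟨ *-distribʳ-+ o (suc (m / o)) (suc (n / o)) ⟨
  (suc (m / o) + suc (n / o)) * o            ≡⟨ cong (λ k → suc k * o) (+-suc (m / o) (n / o)) ⟩
  suc (suc (m / o + n / o)) * o              ∎))
  where open ≤-Reasoning

-- Maximizes φ - ψ on the range 0 to n; the comparisons are written as sums because the difference
-- may be negative.
argmax : ∀ (φ ψ : ℕ → ℕ) n → ∃ λ m → m ≤ n × (∀ i → i ≤ n → φ i + ψ m ≤ φ m + ψ i)
argmax φ ψ zero = 0 , z≤n , λ { zero z≤n → ≤-refl }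
argmax φ ψ (suc n) with argmax φ ψ n
... | m , m≤n , max with ≤-total (φ (suc n) + ψ m) (φ m + ψ (suc n))
...   | inj₁ le = m , m≤n⇒m≤1+n m≤n , extend
  where
  extend : ∀ i → i ≤ suc n → φ i + ψ m ≤ φ m + ψ i
  extend i i≤ with m≤n⇒m<n∨m≡n i≤
  ... | inj₁ i< = max i (s≤s⁻¹ i<)
  ... | inj₂ refl = le
...   | inj₂ ge = suc n , ≤-refl , extend
  where
  open ≤-Reasoning
  extend : ∀ i → i ≤ suc n → φ i + ψ (suc n) ≤ φ (suc n) + ψ i
  extend i i≤ with m≤n⇒m<n∨m≡n i≤
  ... | inj₂ refl = ≤-refl
  ... | inj₁ i< = +-cancelʳ-≤ (φ m + ψ m) _ _ (begin
    φ i + ψ (suc n) + (φ m + ψ m)    ≡⟨ swap (φ i) (ψ (suc n)) (φ m) (ψ m) ⟩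
    φ i + ψ m + (φ m + ψ (suc n))    ≤⟨ +-mono-≤ (max i (s≤s⁻¹ i<)) ge ⟩
    φ m + ψ i + (φ (suc n) + ψ m)    ≡⟨ swap′ (φ m) (ψ i) (φ (suc n)) (ψ m) ⟩
    φ (suc n) + ψ i + (φ m + ψ m)    ∎)
    where
    swap : ∀ a b c d → a + b + (c + d) ≡ a + d + (c + b)
    swap = solve-∀
    swap′ : ∀ a b c d → a + b + (c + d) ≡ c + b + (a + d)
    swap′ = solve-∀

least⊎none : ∀ {P : ℕ → Set} → (∀ n → Dec (P n)) → ∀ n →
  (∃ λ m → P m × (∀ s → s < m → ¬ P s)) ⊎ (∀ s → s < n → ¬ P s)
least⊎none P? zero = inj₂ λ _ ()
least⊎none P? (suc n) with least⊎none P? n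
... | inj₁ least = inj₁ least
... | inj₂ none with P? n
...   | yes p = inj₁ (n , p , none)
...   | no ¬p = inj₂ λ s s<1+n p → case (m≤n⇒m<n∨m≡n (s≤s⁻¹ s<1+n)) of λ
  { (inj₁ s<n) → none s s<n p ; (inj₂ refl) → ¬p p }

module _ {α : ℕ} .{{_ : NonZero α}} (w : Word α) where

  win-% : ∀ i n → win (ext w) (i % α) n ≡ win (ext w) i n
  win-% i n = win-cong n λ k _ → ext-cong w (begin
    (i % α + k) % α              ≡⟨ %-distribˡ-+ (i % α) k α ⟩
    (i % α % α + k % α) % α      ≡⟨ cong (λ l → (l + k % α) % α) (m%n%n≡m%n i α) ⟩
    (i % α + k % α) % α          ≡⟨ %-distribˡ-+ i k α ⟨
    (i + k) % α                  ∎)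
    where open ≡-Reasoning

  win-periods : ∀ i m → win (ext w) i (m * α) ≡ m * ones w
  win-periods i zero    = refl
  win-periods i (suc m) = trans (win-+ (ext w) i α (m * α))
      (cong₂ _+_ (win-period w i) (win-periods (i + α) m))

  win-length-% : ∀ i r → win (ext w) i r ≡ win (ext w) i (r % α) + r / α * ones w
  win-length-% i r = begin
    win (ext w) i r                              ≡⟨ cong (win (ext w) i) (m≡m%n+[m/n]*n r α) ⟩
    win (ext w) i (r % α + r / α * α)            ≡⟨ win-+ (ext w) i (r % α) (r / α * α) ⟩
    win (ext w) i (r % α) + win (ext w) (i + r % α) (r / α * α)
                                                 ≡⟨ cong (win (ext w) i (r % α) +_)
                                                     (win-periods (i + r % α) (r / α)) ⟩
    win (ext w) i (r % α) + r / α * ones w       ∎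
    where open ≡-Reasoning

  gap : ℕ → ℕ → ℕ → ℕ
  gap r i j = ∣ win (ext w) i r - win (ext w) j r ∣

  gap-factor : ∀ r i j → ∣ ones (factor w i r) - ones (factor w j r) ∣ ≡ gap r i j
  gap-factor r i j = cong₂ ∣_-_∣ (ones-factor w i r) (ones-factor w j r)

  gap-% : ∀ r i j → gap (r % α) i j ≡ gap r i j
  gap-% r i j = sym (trans
    (cong₂ ∣_-_∣ (trans (win-length-% i r) (+-comm _ (r / α * ones w)))
        (trans (win-length-% j r) (+-comm _ (r / α * ones w))))
    (∣m+n-m+o∣≡∣n-o∣ (r / α * ones w) _ _))

  balanced-win : Balanced w → ∀ r i j → win (ext w) i r ≤ suc (win (ext w) j r)
  balanced-win bal r i j = ∣-∣≤1⇒≤suc (subst (_≤ 1) (gap-factor r i j) (bal r i j))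

  imbalancedAt? : ∀ r → Dec (ImbalancedAt w r)
  imbalancedAt? r = Dec.map′
    (λ (i , j , le) → toℕ i , toℕ j , subst (2 ≤_) (sym (gap-factor r (toℕ i) (toℕ j))) le)
    (λ (i , j , le) → i mod α , j mod α , subst (2 ≤_)
      (trans (gap-factor r i j) (cong₂ ∣_-_∣ (reduce i) (reduce j))) le)
    (Fin.any? λ i → Fin.any? λ j → 2 ≤? gap r (toℕ i) (toℕ j))
    where
    reduce : ∀ i → win (ext w) i r ≡ win (ext w) (toℕ (i mod α)) r
    reduce i = trans (sym (win-% i r)) (cong (λ k → win (ext w) k r) (sym (toℕ-mod i α)))

  imbalancedAt-% : ∀ {r} → ImbalancedAt w r → ImbalancedAt w (r % α)
  imbalancedAt-% {r} (i , j , le) = i , j ,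
    subst (2 ≤_) (trans (gap-factor r i j)
        (trans (sym (gap-% r i j)) (sym (gap-factor (r % α) i j)))) le

  -- Whole periods add the same number of ones to every factor, so imbalance at r implies imbalance
  -- at `r % α`, and a search below α decides.
  balanced⊎least : Balanced w ⊎ ∃ (IsLeastImbalanceLength w)
  balanced⊎least with least⊎none imbalancedAt? α
  ... | inj₁ least = inj₂ least
  ... | inj₂ none  = inj₁ λ r i j → ≮⇒≥ λ 1< → none (r % α) (m%n<n r α) (imbalancedAt-% (i , j , 1<))

  ¬imbalanced-win : ∀ r → ¬ ImbalancedAt w r → ∀ i j → win (ext w) i r ≤ suc (win (ext w) j r)
  ¬imbalanced-win r ¬imb i j = ∣-∣≤1⇒≤suc
      (≮⇒≥ λ 1< → ¬imb (i , j , subst (2 ≤_) (sym (gap-factor r i j)) 1<))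

-- The word b and its uniqueness up to rotation

module _ (α ρ : ℕ) .{{_ : NonZero α}} (ρ<α : ρ < α) where

  private
    b = balancedWord α ρ ρ<α

  balancedLetter-+ : ∀ k → balancedLetter α ρ k + k * ρ / α ≡ suc k * ρ / α
  balancedLetter-+ k = m∸n+n≡m (/-monoˡ-≤ α (m≤n+m (k * ρ) ρ))

  [k+mα]ρ/α : ∀ k m → (k + m * α) * ρ / α ≡ k * ρ / α + m * ρ
  [k+mα]ρ/α k m = begin
    (k + m * α) * ρ / α             ≡⟨ cong (_/ α) (expand k m α ρ) ⟩
    (k * ρ + m * ρ * α) / α         ≡⟨ +-distrib-/-∣ʳ (k * ρ) (n∣m*n (m * ρ)) ⟩
    k * ρ / α + m * ρ * α / α       ≡⟨ cong (k * ρ / α +_) (m*n/n≡m (m * ρ) α) ⟩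
    k * ρ / α + m * ρ               ∎
    where
    open ≡-Reasoning
    expand : ∀ k m α ρ → (k + m * α) * ρ ≡ k * ρ + m * ρ * α
    expand = solve-∀

  balancedLetter-% : ∀ k → balancedLetter α ρ (k % α) ≡ balancedLetter α ρ k
  balancedLetter-% k = sym (begin
    balancedLetter α ρ k
      ≡⟨ cong (balancedLetter α ρ) (m≡m%n+[m/n]*n k α) ⟩
    (suc (k % α) + k / α * α) * ρ / α ∸ (k % α + k / α * α) * ρ / α
      ≡⟨ cong₂ _∸_ ([k+mα]ρ/α (suc (k % α)) (k / α)) ([k+mα]ρ/α (k % α) (k / α)) ⟩
    (suc (k % α) * ρ / α + k / α * ρ) ∸ (k % α * ρ / α + k / α * ρ)
      ≡⟨ [m+n]∸[o+n]≡m∸o (suc (k % α) * ρ / α) (k / α * ρ) (k % α * ρ / α) ⟩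
    balancedLetter α ρ (k % α) ∎)
    where
    open ≡-Reasoning
    [m+n]∸[o+n]≡m∸o : ∀ m n o → (m + n) ∸ (o + n) ≡ m ∸ o
    [m+n]∸[o+n]≡m∸o m n o = trans (cong₂ _∸_ (+-comm m n) (+-comm o n)) ([m+n]∸[m+o]≡n∸o n m o)

  ext-balancedWord : ∀ k → ext b k ≡ balancedLetter α ρ k
  ext-balancedWord k = begin
    ext b k                       ≡⟨ ext-cong b (sym (m%n%n≡m%n k α)) ⟩
    ext b (k % α)
      ≡⟨ ext-tabulate (λ k → fromℕ< (balancedLetter<2 α ρ ρ<α k)) (m%n<n k α) ⟩
    toℕ (fromℕ< (balancedLetter<2 α ρ ρ<α (k % α)))
                                  ≡⟨ Fin.toℕ-fromℕ< _ ⟩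
    balancedLetter α ρ (k % α)    ≡⟨ balancedLetter-% k ⟩
    balancedLetter α ρ k          ∎
    where open ≡-Reasoning

  -- The letters of b are differences of consecutive quotients, so the sum telescopes.
  win-balancedWord : ∀ i r → win (ext b) i r + i * ρ / α ≡ (i + r) * ρ / α
  win-balancedWord i zero    = cong (λ k → k * ρ / α) (sym (+-identityʳ i))
  win-balancedWord i (suc r) = begin
    ext b i + win (ext b) (suc i) r + i * ρ / α                    ≡⟨ rearrange (ext b i) _ _ ⟩
    win (ext b) (suc i) r + (ext b i + i * ρ / α)
      ≡⟨ cong (λ l → win (ext b) (suc i) r + (l + i * ρ / α)) (ext-balancedWord i) ⟩
    win (ext b) (suc i) r + (balancedLetter α ρ i + i * ρ / α)
      ≡⟨ cong (win (ext b) (suc i) r +_) (balancedLetter-+ i) ⟩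
    win (ext b) (suc i) r + suc i * ρ / α                          ≡⟨ win-balancedWord (suc i) r ⟩
    (suc i + r) * ρ / α
      ≡⟨ cong (λ k → k * ρ / α) (+-suc i r) ⟨
    (i + suc r) * ρ / α                                            ∎
    where
    open ≡-Reasoning
    rearrange : ∀ x y z → x + y + z ≡ y + (x + z)
    rearrange = solve-∀

  win-balancedWord-≤ : ∀ i r → win (ext b) i r ≤ suc (r * ρ / α)
  win-balancedWord-≤ i r = +-cancelʳ-≤ (i * ρ / α) _ _ (begin
    win (ext b) i r + i * ρ / α    ≡⟨ win-balancedWord i r ⟩
    (i + r) * ρ / α                ≡⟨ cong (_/ α) (*-distribʳ-+ ρ i r) ⟩
    (i * ρ + r * ρ) / α            ≤⟨ [m+n]/o≤1+m/o+n/o (i * ρ) (r * ρ) α ⟩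
    suc (i * ρ / α + r * ρ / α)    ≡⟨ cong suc (+-comm (i * ρ / α) _) ⟩
    suc (r * ρ / α) + i * ρ / α    ∎)
    where open ≤-Reasoning

  win-balancedWord-≥ : ∀ i r → r * ρ / α ≤ win (ext b) i r
  win-balancedWord-≥ i r = +-cancelʳ-≤ (i * ρ / α) _ _ (begin
    r * ρ / α + i * ρ / α          ≡⟨ +-comm (r * ρ / α) _ ⟩
    i * ρ / α + r * ρ / α          ≤⟨ m/o+n/o≤[m+n]/o (i * ρ) (r * ρ) α ⟩
    (i * ρ + r * ρ) / α            ≡⟨ cong (_/ α) (*-distribʳ-+ ρ i r) ⟨
    (i + r) * ρ / α                ≡⟨ win-balancedWord i r ⟨
    win (ext b) i r + i * ρ / α    ∎)
    where open ≤-Reasoning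

  balancedWord-balanced : Balanced b
  balancedWord-balanced r i j = subst (_≤ 1) (sym (gap-factor b r i j)) (≤suc⇒∣-∣≤1
    (≤-trans (win-balancedWord-≤ i r) (s≤s (win-balancedWord-≥ j r)))
    (≤-trans (win-balancedWord-≤ j r) (s≤s (win-balancedWord-≥ i r))))

  win-balancedWord-0 : ∀ r → win (ext b) 0 r ≡ r * ρ / α
  win-balancedWord-0 r = trans (sym (+-identityʳ _))
    (trans (cong (win (ext b) 0 r +_) (sym (0/n≡0 α))) (win-balancedWord 0 r))

  ones-balancedWord : ones b ≡ ρ
  ones-balancedWord = trans (ones-win b) (trans (win-balancedWord-0 α)
    (trans (cong (_/ α) (*-comm α ρ)) (m*n/n≡m ρ α)))

  module _ (w : Word α) (ones≡ : ones w ≡ ρ) (bal : Balanced w) where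

    private
      a = ext w
      peak = argmax (λ i → α * win a 0 i) (_* ρ) α
      i₀ = proj₁ peak

    -- i₀ maximizes α S(i) − iρ, where S(i) is the number of ones before i.
    peak-≤ : ∀ r → α * win a i₀ r ≤ r * ρ
    peak-≤ r = +-cancelʳ-≤ (α * win a 0 i₀ + i₀ * ρ) _ _ (begin
      α * win a i₀ r + (α * win a 0 i₀ + i₀ * ρ)            ≡⟨ l₁ α (win a i₀ r) (win a 0 i₀) (i₀ * ρ) ⟩
      α * (win a 0 i₀ + win a i₀ r) + i₀ * ρ
        ≡⟨ cong (λ s → α * s + i₀ * ρ) (win-+ a 0 i₀ r) ⟨
      -- Advancing i by α raises both α S(i) and iρ by αρ. Reducing i₀ + r modulo α therefore brings
      -- it into the range searched by `argmax`.
      α * win a 0 (i₀ + r) + i₀ * ρ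
        ≡⟨ cong (λ s → α * s + i₀ * ρ)
            (trans (win-length-% w 0 (i₀ + r)) (cong (λ o → win a 0 (k % α) + k / α * o) ones≡)) ⟩
      α * (win a 0 (k % α) + k / α * ρ) + i₀ * ρ
        ≡⟨ l₂ α (win a 0 (k % α)) (k / α) ρ (i₀ * ρ) ⟩
      α * win a 0 (k % α) + i₀ * ρ + k / α * α * ρ
        ≤⟨ +-monoˡ-≤ _ (proj₂ (proj₂ peak) (k % α) (<⇒≤ (m%n<n k α))) ⟩
      α * win a 0 i₀ + k % α * ρ + k / α * α * ρ
        ≡⟨ l₃ (α * win a 0 i₀) (k % α) (k / α * α) ρ ⟩
      α * win a 0 i₀ + (k % α + k / α * α) * ρ
        ≡⟨ cong (λ l → α * win a 0 i₀ + l * ρ) (m≡m%n+[m/n]*n k α) ⟨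
      α * win a 0 i₀ + (i₀ + r) * ρ                         ≡⟨ l₄ (α * win a 0 i₀) i₀ r ρ ⟩
      r * ρ + (α * win a 0 i₀ + i₀ * ρ)                     ∎)
      where
      open ≤-Reasoning
      k = i₀ + r
      l₁ : ∀ α x y z → α * x + (α * y + z) ≡ α * (y + x) + z
      l₁ = solve-∀
      l₂ : ∀ α x m ρ z → α * (x + m * ρ) + z ≡ α * x + z + m * α * ρ
      l₂ = solve-∀
      l₃ : ∀ x y z ρ → x + y * ρ + z * ρ ≡ x + (y + z) * ρ
      l₃ = solve-∀
      l₄ : ∀ x i r ρ → x + (i + r) * ρ ≡ r * ρ + (x + i * ρ)
      l₄ = solve-∀

    win-multiple-≤ : ∀ {r R} → (∀ i → win a i r ≤ R) → ∀ m i → win a i (m * r) ≤ m * R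
    win-multiple-≤ le zero    i = z≤n
    win-multiple-≤ {r} {R} le (suc m) i = ≤-trans (≤-reflexive (win-+ a i r (m * r)))
      (+-mono-≤ (le i) (win-multiple-≤ le m (i + r)))

    win-peak-≤ : ∀ r → win a i₀ r ≤ r * ρ / α
    win-peak-≤ r = begin
      win a i₀ r            ≡⟨ m*n/n≡m (win a i₀ r) α ⟨
      win a i₀ r * α / α    ≡⟨ cong (_/ α) (*-comm (win a i₀ r) α) ⟩
      α * win a i₀ r / α    ≤⟨ /-monoˡ-≤ α (peak-≤ r) ⟩
      r * ρ / α             ∎
      where open ≤-Reasoning

    -- Otherwise every factor of length r has at most ⌊rρ/α⌋ ones, and one has
    -- fewer, so that α consecutive ones contain fewer than rρ ones.
    win-peak-≥ : ∀ r → r * ρ / α ≤ win a i₀ r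
    win-peak-≥ r = ≮⇒≥ λ small → <-irrefl refl (begin-strict
      r * ρ                                          ≡⟨ cong (r *_) ones≡ ⟨
      r * ones w                                     ≡⟨ win-periods w i₀ r ⟨
      win a i₀ (r * α)
        ≡⟨ cong (win a i₀) (trans (*-comm r α) (cong (_* r) (sym (suc-pred α)))) ⟩
      win a i₀ (r + pred α * r)                      ≡⟨ win-+ a i₀ r (pred α * r) ⟩
      win a i₀ r + win a (i₀ + r) (pred α * r)
        <⟨ +-mono-<-≤ small (win-multiple-≤ (λ i → ≤-trans (balanced-win w bal r i i₀) small)
            (pred α) (i₀ + r)) ⟩
      r * ρ / α + pred α * (r * ρ / α)               ≡⟨ cong (_* (r * ρ / α)) (suc-pred α) ⟩
      α * (r * ρ / α)                                ≡⟨ *-comm α _ ⟩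
      r * ρ / α * α                                  ≤⟨ m/n*n≤m (r * ρ) α ⟩
      r * ρ                                          ∎)
      where open ≤-Reasoning

    win-peak : ∀ r → win a i₀ r ≡ win (ext b) 0 r
    win-peak r = trans (≤-antisym (win-peak-≤ r) (win-peak-≥ r)) (sym (win-balancedWord-0 r))

    ext-peak : ∀ r → a (i₀ + r) ≡ ext b r
    ext-peak r = +-cancelˡ-≡ (win a i₀ r) _ _ (begin
      win a i₀ r + a (i₀ + r)        ≡⟨ win-∷ʳ a i₀ r ⟨
      win a i₀ (suc r)               ≡⟨ win-peak (suc r) ⟩
      win (ext b) 0 (suc r)          ≡⟨ win-∷ʳ (ext b) 0 r ⟩
      win (ext b) 0 r + ext b r      ≡⟨ cong (_+ ext b r) (win-peak r) ⟨
      win a i₀ r + ext b r           ∎)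
      where open ≡-Reasoning

    balanced-rotation : w IsRotationOf b
    -- From position i₀ on, the periodic extension of w reads as b, and α - i₀ letters later the
    -- next copy of w begins.
    balanced-rotation = α ∸ i₀ , trans (sym (Vec.tabulate∘lookup w))
        (Vec.tabulate-cong λ k → Fin.toℕ-injective (begin
      toℕ (lookup w k)                   ≡⟨ cong (toℕ {2}) (ext-toℕ w k) ⟩
      a (toℕ k)                          ≡⟨ ext-periodic w (toℕ k) ⟨
      a (toℕ k + α)
        ≡⟨ cong a (trans (+-comm (toℕ k) α)
            (trans (cong (_+ toℕ k) (sym (m+[n∸m]≡n (proj₁ (proj₂ peak))))) (+-assoc i₀ _ (toℕ k)))) ⟩
      a (i₀ + (α ∸ i₀ + toℕ k))          ≡⟨ ext-peak (α ∸ i₀ + toℕ k) ⟩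
      ext b (α ∸ i₀ + toℕ k)             ∎))
      where open ≡-Reasoning

-- Counting independent sets

does-⇔ : ∀ {A B : Set} → A ⇔ B → (a? : Dec A) (b? : Dec B) → does a? ≡ does b?
does-⇔ A⇔B a? b? = does-≡ (Dec.map A⇔B a?) b?

length-filter-map : ∀ {A B : Set} {P : B → Set} (P? : Decidable₁ P) (f : A → B) xs →
  length (filter P? (map f xs)) ≡ length (filter (P? ∘ f) xs)
length-filter-map P? f [] = refl
length-filter-map P? f (x ∷ xs) with does (P? (f x))
... | true  = cong suc (length-filter-map P? f xs)
... | false = length-filter-map P? f xs

if-cong : ∀ {b b′ : Bool} {f g h : Series} → b ≡ b′ → f ≗ g →
  (if b then f else h) ≗ (if b′ then g else h)
if-cong {true}  refl eq = eq
if-cong {false} refl eq = λ _ → refl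

length-subsets : ∀ {A : Set} (xs : List A) → length (subsets xs) ≡ 2 ^ length xs
length-subsets []       = refl
length-subsets (x ∷ xs) = begin
  length (map (x ∷_) (subsets xs) ++ subsets xs)
    ≡⟨ List.length-++ (map (x ∷_) (subsets xs)) ⟩
  length (map (x ∷_) (subsets xs)) + length (subsets xs)
    ≡⟨ cong₂ _+_ (trans (List.length-map (x ∷_) (subsets xs)) (length-subsets xs)) (length-subsets xs) ⟩
  2 ^ length xs + 2 ^ length xs
    ≡⟨ cong (2 ^ length xs +_) (+-identityʳ _) ⟨
  2 ^ suc (length xs)                                        ∎
  where open ≡-Reasoning

module _ (G : Graph) where
  open Graph G

  -- Crude, but it bounds the number of improvement steps.
  indepCount≤2^ : ∀ j → indepCount G j ≤ 2 ^ length vertices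
  indepCount≤2^ j = ≤-trans
    (List.length-filter (λ S → independent? G S ×-dec length S ≟ j) (subsets vertices))
    (≤-reflexive (length-subsets vertices))

  allowing : ∀ {P : V → Set} → Decidable₁ P → ∀ v → Decidable₁ (λ u → P u × ¬ Adj v u)
  allowing P? v u = P? u ×-dec ¬? (adj? v u)

  -- The generating series of the independent sublists with all elements in P.
  gen : ∀ {P : V → Set} → Decidable₁ P → List V → Series
  gen P? []      = 1ˢ
  gen P? (v ∷ L) = (if does (P? v) then shift (gen (allowing P? v) L) else 0ˢ) ⊕ gen P? L

  gen-counts : ∀ {P : V → Set} (P? : Decidable₁ P) L j →
    length (filter (λ S → all? P? S ×-dec independent? G S ×-dec length S ≟ j) (subsets L)) ≡ gen P? L j
  gen-counts P? [] zero    = refl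
  gen-counts P? [] (suc j) = refl
  gen-counts {P} P? (v ∷ L) j = begin
    length (filter Q? (map (v ∷_) (subsets L) ++ subsets L))
      ≡⟨ cong length (List.filter-++ Q? (map (v ∷_) (subsets L)) (subsets L)) ⟩
    length (filter Q? (map (v ∷_) (subsets L)) ++ filter Q? (subsets L))
      ≡⟨ List.length-++ (filter Q? (map (v ∷_) (subsets L))) ⟩
    length (filter Q? (map (v ∷_) (subsets L))) + length (filter Q? (subsets L))
      ≡⟨ cong₂ _+_ (trans (length-filter-map Q? (v ∷_) (subsets L)) (with-v j (P? v)))
          (gen-counts P? L j) ⟩
    gen P? (v ∷ L) j ∎
    where
    open ≡-Reasoning
    Q? = λ S → all? P? S ×-dec independent? G S ×-dec length S ≟ j

    with-v : ∀ j (p? : Dec (P v)) →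
      length (filter (λ S → all? P? (v ∷ S) ×-dec independent? G (v ∷ S) ×-dec suc (length S) ≟ j)
          (subsets L))
      ≡ (if does p? then shift (gen (allowing P? v) L) else 0ˢ) j
    with-v j (no ¬p) = cong length (List.filter-none
      (λ S → all? P? (v ∷ S) ×-dec independent? G (v ∷ S) ×-dec suc (length S) ≟ j)
      (All.universal (λ { S (p ∷ _ , _) → ¬p p }) (subsets L)))
    with-v zero (yes p) = cong length (List.filter-none
      (λ S → all? P? (v ∷ S) ×-dec independent? G (v ∷ S) ×-dec suc (length S) ≟ 0)
      (All.universal (λ { S (_ , _ , ()) }) (subsets L)))
    with-v (suc j) (yes p) = trans
      (cong length (List.filter-≐
        (λ S → all? P? (v ∷ S) ×-dec independent? G (v ∷ S) ×-dec suc (length S) ≟ suc j)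
        (λ S → all? (allowing P? v) S ×-dec independent? G S ×-dec length S ≟ j)
        ( (λ { (_ ∷ ps , na ∷ ind , eq) → All.zip (ps , na) , ind , suc-injective eq })
        , (λ { (ps , ind , eq) → p ∷ All.map proj₁ ps , All.map proj₂ ps ∷ ind , cong suc eq }))
        (subsets L)))
      (gen-counts (allowing P? v) L j)

  indepCount≡gen : ∀ j → indepCount G j ≡ gen (λ _ → yes tt) vertices j
  indepCount≡gen j = trans
    (cong length (List.filter-≐
      (λ S → independent? G S ×-dec length S ≟ j)
      (λ S → all? {P = λ _ → ⊤} (λ _ → yes tt) S ×-dec independent? G S ×-dec length S ≟ j)
      ((λ p → All.universal (λ _ → tt) _ , p) , proj₂) (subsets vertices)))
    (gen-counts (λ _ → yes tt) vertices j)

  gen-cong : ∀ {P P′ : V → Set} (P? : Decidable₁ P) (P′? : Decidable₁ P′) {L} →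
    All (λ v → P v ⇔ P′ v) L → gen P? L ≗ gen P′? L
  gen-cong P? P′? [] n = refl
  gen-cong P? P′? {v ∷ L} (eq ∷ eqs) = S.+-cong
    (if-cong (does-⇔ eq (P? v) (P′? v)) (shift-cong (gen-cong (allowing P? v) (allowing P′? v)
      (All.map (λ e → mk⇔ (λ (p , na) → to e p , na) (λ (p , na) → from e p , na)) eqs))))
    (gen-cong P? P′? eqs)

  gen-excluded : ∀ {P : V → Set} (P? : Decidable₁ P) {K} L → All (λ v → ¬ P v) K →
    gen P? (K ++ L) ≗ gen P? L
  gen-excluded P? L [] = λ _ → refl
  gen-excluded P? {v ∷ K} L (¬p ∷ ¬ps) n rewrite dec-false (P? v) ¬p = gen-excluded P? L ¬ps n

  -- The contribution of the sublists with exactly one element in K.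
  genOne : ∀ {P : V → Set} → Decidable₁ P → List V → List V → Series
  genOne P? []      L = 0ˢ
  genOne P? (v ∷ K) L = (if does (P? v) then shift (gen (allowing P? v) L) else 0ˢ) ⊕ genOne P? K L

  -- Choosing v rules out the rest of K, since all of it is adjacent to v.
  gen-clique : ∀ {P : V → Set} (P? : Decidable₁ P) {K} L → AllPairs Adj K →
    gen P? (K ++ L) ≗ genOne P? K L ⊕ gen P? L
  gen-clique P? L [] n = refl
  gen-clique P? {v ∷ K} L (adj ∷ adjs) n = trans
    (cong₂ _+_
      (if-cong {does (P? v)} refl (shift-cong
          (gen-excluded (allowing P? v) L (All.map (λ a (_ , ¬a) → ¬a a) adj))) n)
      (gen-clique P? L adjs n))
    (sym (+-assoc _ (genOne P? K L n) (gen P? L n)))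

  genOne-uniform : ∀ {P : V → Set} (P? : Decidable₁ P) {A K} L →
    All (λ v → P v × gen (allowing P? v) L ≗ A) K → genOne P? K L ≗ (λ n → length K * shift A n)
  genOne-uniform P? L [] n = refl
  genOne-uniform P? {K = v ∷ K} L ((p , eq) ∷ rest) n rewrite dec-true (P? v) p =
    cong₂ _+_ (shift-cong eq n) (genOne-uniform P? L rest n)

-- The list `allFin` with a running position, so that the scan of the cliques follows the recursion
-- of `prod`.
fins : ∀ (α : ℕ) .{{_ : NonZero α}} → ℕ → ℕ → List (Fin α)
fins α i zero    = []
fins α i (suc n) = i mod α ∷ fins α (suc i) n

fins-tabulate : ∀ {α} .{{_ : NonZero α}} {n} (h : Fin n → Fin α) i →
  (∀ k → toℕ (h k) ≡ (i + toℕ k) % α) → List.tabulate h ≡ fins α i n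
fins-tabulate {n = zero} h i eq = refl
fins-tabulate {α} {n = suc n} h i eq = cong₂ _∷_
  (Fin.toℕ-injective (trans (eq Fin.zero) (trans (cong (_% α) (+-identityʳ i)) (sym (toℕ-mod i α)))))
  (fins-tabulate (h ∘ Fin.suc) (suc i) λ k → trans (eq (Fin.suc k)) (cong (_% α) (+-suc i (toℕ k))))

allFin≡fins : ∀ α .{{_ : NonZero α}} → allFin α ≡ fins α 0 α
allFin≡fins α = fins-tabulate id 0 λ k → sym (m<n⇒m%n≡m (Fin.toℕ<n k))

fins-> : ∀ {α} .{{_ : NonZero α}} i n → suc i + n ≡ α → All (λ j → i < toℕ j) (fins α (suc i) n)
fins-> i zero    eq = []
fins-> {α} i (suc n) eq =
  subst (i <_) (sym (trans (toℕ-mod (suc i) α)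
      (m<n⇒m%n≡m (subst (suc i <_) eq (m<m+n (suc i) z<s))))) ≤-refl
  ∷ All.map (<-trans ≤-refl) (fins-> (suc i) n (trans (cong suc (sym (+-suc i n))) eq))

-- Scanning the cliques in cyclic order

module Chain {α : ℕ} .{{_ : NonZero α}} (q′ : ℕ) (w : Word α) where

  open Products q′

  q : ℕ
  q = suc (suc q′)

  G : Graph
  G = C q w

  block : ℕ → ℕ → List (CVertex q w)
  block i n = concat (map (clique q w) (fins α i n))

  -- The vertices of later cliques not yet excluded: f records that x₀, and g
  -- that y_{i-1}, belongs to the independent set.
  Allowed : Bool → Bool → ℕ → CVertex q w → Set
  Allowed f g i (j , u) =
    ¬ (f ≡ true × suc (toℕ j) ≡ α × toℕ u ≡ 1) × ¬ (g ≡ true × toℕ j ≡ i × toℕ u ≡ 0)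

  allowed? : ∀ f g i → Decidable₁ (Allowed f g i)
  allowed? f g i (j , u) =
    ¬? (f Bool.≟ true ×-dec suc (toℕ j) ≟ α ×-dec toℕ u ≟ 1) ×-dec
    ¬? (g Bool.≟ true ×-dec toℕ j ≟ i ×-dec toℕ u ≟ 0)

  toℕ-next : ∀ (j : Fin α) → suc (toℕ j) < α → toℕ (next q w j) ≡ suc (toℕ j)
  toℕ-next j j<α = trans (toℕ-mod (suc (toℕ j)) α) (m<n⇒m%n≡m j<α)

  toℕ-next-last : ∀ (j : Fin α) → suc (toℕ j) ≡ α → toℕ (next q w j) ≡ 0
  toℕ-next-last j eq = trans (toℕ-mod (suc (toℕ j)) α) (trans (cong (_% α) eq) (n%n≡0 α))

  -- A later clique can be linked to clique c in two ways only: as its successor, through y of c, or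
  -- as the last clique when c is the first, through the closing link at x₀.
  adj-forward : ∀ c (k : Fin (cliqueSize q w c)) (z : CVertex q w) → let (j , u) = z in toℕ c < toℕ j →
    CAdj q w (c , k) z ⇔
      ((toℕ k ≡ 0 × toℕ c ≡ 0) × suc (toℕ j) ≡ α × toℕ u ≡ 1 ⊎
       toℕ k ≡ 1 × toℕ j ≡ suc (toℕ c) × toℕ u ≡ 0)
  adj-forward c k (j , u) c<j = mk⇔ ⇒ ⇐
    where
    c+1<α : suc (toℕ c) < α
    c+1<α = ≤-<-trans c<j (Fin.toℕ<n j)
    ⇒ : CAdj q w (c , k) (j , u) → _
    ⇒ (inj₁ (refl , _)) = contradiction c<j (<-irrefl refl)
    ⇒ (inj₂ (inj₁ (j≡ , k≡1 , u≡0))) = inj₂ (k≡1 , trans (cong toℕ j≡) (toℕ-next c c+1<α) , u≡0)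
    ⇒ (inj₂ (inj₂ (c≡ , u≡1 , k≡0))) with suc (toℕ j) ≟ α
    ... | yes eq = inj₁ ((k≡0 , trans (cong toℕ c≡) (toℕ-next-last j eq)) , eq , u≡1)
    ... | no neq = contradiction (subst (_< toℕ j)
        (trans (cong toℕ c≡) (toℕ-next j (≤∧≢⇒< (Fin.toℕ<n j) neq))) c<j)
                     (≤⇒≯ (n≤1+n _))
    ⇐ : _ → CAdj q w (c , k) (j , u)
    ⇐ (inj₁ ((k≡0 , c≡0) , eq , u≡1)) =
      inj₂ (inj₂ (Fin.toℕ-injective (trans c≡0 (sym (toℕ-next-last j eq))) , u≡1 , k≡0))
    ⇐ (inj₂ (k≡1 , j≡ , u≡0)) =
      inj₂ (inj₁ (Fin.toℕ-injective (trans j≡ (sym (toℕ-next c c+1<α))) , k≡1 , u≡0))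

  allowed-skip : ∀ {f g i} (z : CVertex q w) → i < toℕ (proj₁ z) →
    Allowed f g i z ⇔ Allowed f false (suc i) z
  allowed-skip z i<j = mk⇔
    (λ (a , _) → a , λ ())
    (λ (a , _) → a , λ (_ , j≡i , _) → <-irrefl (sym j≡i) i<j)

  allowed-choose : ∀ {f f′ g g′} c (k : Fin (cliqueSize q w c)) (z : CVertex q w) →
    toℕ c < toℕ (proj₁ z) →
    f′ ≡ true ⇔ (f ≡ true ⊎ toℕ k ≡ 0 × toℕ c ≡ 0) → g′ ≡ true ⇔ toℕ k ≡ 1 →
    (Allowed f g (toℕ c) z × ¬ CAdj q w (c , k) z) ⇔ Allowed f′ g′ (suc (toℕ c)) z
  allowed-choose {f} {f′} c k z@(j , u) c<j f⇔ g⇔ = mk⇔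
    (λ { ((a , _) , ¬adj) →
         (λ (f′≡ , last) → case-f (to f⇔ f′≡) a ¬adj last)
       , (λ (g′≡ , next) → ¬adj (from adj (inj₂ (to g⇔ g′≡ , next)))) })
    (λ { (a , b) →
         ( (λ (f≡ , last) → a (from f⇔ (inj₁ f≡) , last))
         , (λ (_ , j≡c , _) → <-irrefl (sym j≡c) c<j))
       , (λ ad → case-adj (to adj ad) a b) })
    where
    adj = adj-forward c k z c<j
    case-f : f ≡ true ⊎ toℕ k ≡ 0 × toℕ c ≡ 0 → ¬ (f ≡ true × suc (toℕ j) ≡ α × toℕ u ≡ 1) →
      ¬ CAdj q w (c , k) z → ¬ (suc (toℕ j) ≡ α × toℕ u ≡ 1)
    case-f (inj₁ f≡) a ¬adj last = a (f≡ , last)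
    case-f (inj₂ k0) a ¬adj last = ¬adj (from adj (inj₁ (k0 , last)))
    case-adj : _ → ¬ (f′ ≡ true × suc (toℕ j) ≡ α × toℕ u ≡ 1) →
      ¬ (_ × toℕ j ≡ suc (toℕ c) × toℕ u ≡ 0) → ⊥
    case-adj (inj₁ (k0 , last)) a b = a (from f⇔ (inj₂ k0) , last)
    case-adj (inj₂ (k≡1 , next)) a b = b (from g⇔ k≡1 , next)

  clique-adj : ∀ c → AllPairs (CAdj q w) (clique q w c)
  clique-adj c = AllPairs.map⁺ (AllPairs.map (λ i≢j → inj₁ (refl , λ { refl → i≢j refl }))
      (Unique.allFin⁺ (cliqueSize q w c)))

  block-> : ∀ i n → suc i + n ≡ α → All (λ z → i < toℕ (proj₁ z)) (block (suc i) n)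
  block-> i n eq = All.concat⁺ (All.map⁺
      (All.map (λ {j} i<j → All.map⁺ (All.universal (λ _ → i<j) _)) (fins-> i n eq)))

  genA : Bool → Bool → ℕ → List (CVertex q w) → Series
  genA f g i = gen G (allowed? f g i)

  module Step (i n : ℕ) (eq : suc i + n ≡ α) where
    c : Fin α
    c = i mod α
    toℕ-c : toℕ c ≡ i
    toℕ-c = trans (toℕ-mod i α) (m<n⇒m%n≡m (subst (i <_) eq (m≤m+n (suc i) n)))
    L = block (suc i) n

    gen-skip : ∀ f g → genA f g i L ≗ genA f false (suc i) L
    gen-skip f g = gen-cong G (allowed? f g i) (allowed? f false (suc i))
      (All.map (λ {z} → allowed-skip {f} {g} z) (block-> i n eq))

    gen-choose : ∀ {f f′ g g′} k → f′ ≡ true ⇔ (f ≡ true ⊎ toℕ k ≡ 0 × i ≡ 0) → g′ ≡ true ⇔ toℕ k ≡ 1 →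
      gen G (allowing G (allowed? f g i) (c , k)) L ≗ genA f′ g′ (suc i) L
    gen-choose {f} {f′} {g} {g′} k f⇔ g⇔ = gen-cong G (allowing G (allowed? f g i) (c , k))
        (allowed? f′ g′ (suc i))
      (All.map (λ {z} → choose z) (block-> i n eq))
      where
      choose : ∀ z → i < toℕ (proj₁ z) →
        (Allowed f g i z × ¬ CAdj q w (c , k) z) ⇔ Allowed f′ g′ (suc i) z
      choose z = subst (λ i → f′ ≡ true ⇔ (f ≡ true ⊎ toℕ k ≡ 0 × i ≡ 0) → i < toℕ (proj₁ z) →
          (Allowed f g i z × ¬ CAdj q w (c , k) z) ⇔ Allowed f′ g′ (suc i) z) toℕ-c
        (λ f⇔ i< → allowed-choose c k z i< f⇔ g⇔) f⇔

    others : ℕ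
    others = q′ + toℕ (lookup w c)

    chosen : Bool → Bool → Fin (cliqueSize q w c) → Series
    chosen f g k = if does (allowed? f g i (c , k))
      then shift (gen G (allowing G (allowed? f g i) (c , k)) L) else 0ˢ

    -- The vertices 0 and 1 carry the links and change the state. Each other vertex leaves the same
    -- state as choosing none, and together these choices form the weight.
    gen-step : ∀ f g → genA f g i (block i (suc n)) ≗
      chosen f g Fin.zero ⊕ (chosen f g (Fin.suc Fin.zero) ⊕
        weight (toℕ (lookup w c)) ⊛ genA f false (suc i) L)
    gen-step f g j = trans (gen-clique G (allowed? f g i) L (clique-adj c) j)
      (trans (+-assoc (chosen f g Fin.zero j) _ (genA f g i L j)) (cong (chosen f g Fin.zero j +_)
        (trans (+-assoc (chosen f g (Fin.suc Fin.zero) j) _ (genA f g i L j))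
            (cong (chosen f g (Fin.suc Fin.zero) j +_) final))))
      where
      A = genA f false (suc i) L
      rest = map (c ,_) (List.tabulate {n = others} (Fin.suc ∘ Fin.suc))
      uniform : All (λ v → Allowed f g i v × gen G (allowing G (allowed? f g i) v) L ≗ A) rest
      uniform = All.map⁺ (All.tabulate⁺ λ k →
        ((λ { (_ , _ , ()) }) , (λ { (_ , _ , ()) })) ,
        gen-choose (Fin.suc (Fin.suc k)) (mk⇔ inj₁ (λ { (inj₁ f≡) → f≡ ; (inj₂ (() , _)) }))
            (mk⇔ (λ ()) (λ ())))
      final : genOne G (allowed? f g i) rest L j + genA f g i L j ≡ (weight (toℕ (lookup w c)) ⊛ A) j
      final = trans
        (cong₂ _+_
          (trans (genOne-uniform G (allowed? f g i) L uniform j)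
            (cong (_* shift A j) (trans (List.length-map (c ,_)
                (List.tabulate {n = others} (Fin.suc ∘ Fin.suc)))
                                        (List.length-tabulate {n = others} (Fin.suc ∘ Fin.suc)))))
          (gen-skip f g j))
        (sym (weight⊛ (toℕ (lookup w c)) A j))

    chosen-allowed : ∀ {f f′ g g′} k → Allowed f g i (c , k) →
      f′ ≡ true ⇔ (f ≡ true ⊎ toℕ k ≡ 0 × i ≡ 0) → g′ ≡ true ⇔ toℕ k ≡ 1 →
      chosen f g k ≗ X ⊛ genA f′ g′ (suc i) L
    chosen-allowed {f} {f′} {g} {g′} k p f⇔ g⇔ n rewrite dec-true (allowed? f g i (c , k)) p =
      trans (shift-cong (gen-choose k f⇔ g⇔) n) (sym (X⊛ (genA f′ g′ (suc i) L) n))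

    chosen-excluded : ∀ {f g} k → ¬ Allowed f g i (c , k) → chosen f g k ≗ 0ˢ
    chosen-excluded {f} {g} k ¬p n rewrite dec-false (allowed? f g i (c , k)) ¬p = refl

  -- The states f and g as for Allowed.
  row : Bool → Bool → Mat → Series
  row f g M = (if g then e₂₁ M else e₁₁ M) ⊕ (if f then 0ˢ else (if g then e₂₂ M else e₁₂ M))

  -- g selects the row. f drops the second column, which counts the sets containing the last y, a
  -- neighbour of x₀. The three terms on the right are the choices of x, of y, and of neither.
  row-letter : ∀ f g c M → row f g (letter c · M) ≗
    (if g then 0ˢ else X ⊛ row f false M) ⊕ (X ⊛ row f true M ⊕ weight c ⊛ row f false M)
  row-letter true  true  c M = solve 4
      (λ s x a c → (s :* a :+ x :* c) :+ con 0 := con 0 :+ (x :* (c :+ con 0) :+ s :* (a :+ con 0)))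
    S.refl (weight c) X (e₁₁ M) (e₂₁ M)
  row-letter true  false c M = solve 4
      (λ s x a c → ((s :+ x) :* a :+ x :* c) :+ con 0 := x :* (a :+ con 0) :+
          (x :* (c :+ con 0) :+ s :* (a :+ con 0)))
    S.refl (weight c) X (e₁₁ M) (e₂₁ M)
  row-letter false true  c M = solve 6
      (λ s x a b c d → (s :* a :+ x :* c) :+ (s :* b :+ x :* d) := con 0 :+
          (x :* (c :+ d) :+ s :* (a :+ b)))
    S.refl (weight c) X (e₁₁ M) (e₁₂ M) (e₂₁ M) (e₂₂ M)
  row-letter false false c M = solve 6
      (λ s x a b c d → ((s :+ x) :* a :+ x :* c) :+ ((s :+ x) :* b :+ x :* d) := x :* (a :+ b) :+
          (x :* (c :+ d) :+ s :* (a :+ b)))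
    S.refl (weight c) X (e₁₁ M) (e₁₂ M) (e₂₁ M) (e₂₂ M)

  module LaterStep (i n : ℕ) (eq : suc (suc i) + n ≡ α) where
    open Step (suc i) n eq public

    l : ℕ
    l = toℕ (lookup w c)
    R : Mat
    R = prod (ext w) (suc (suc i)) n

    unchanged : ∀ {f : Bool} k → f ≡ true ⇔ (f ≡ true ⊎ toℕ {cliqueSize q w c} k ≡ 0 × suc i ≡ 0)
    unchanged k = mk⇔ inj₁ (λ { (inj₁ e) → e ; (inj₂ (_ , ())) })

    gen-row : ∀ f g → genA f false (suc (suc i)) L ≗ row f false R →
      chosen f g (Fin.suc Fin.zero) ≗ X ⊛ row f true R →
      genA f g (suc i) (block (suc i) (suc n)) ≗ row f g (prod (ext w) (suc i) (suc n))
    gen-row f g skip second = begin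
      genA f g (suc i) (block (suc i) (suc n))
        ≈⟨ gen-step f g ⟩
      chosen f g Fin.zero ⊕ (chosen f g (Fin.suc Fin.zero) ⊕ weight l ⊛ genA f false (suc (suc i)) L)
        ≈⟨ S.+-cong (first g) (S.+-cong second (S.*-congˡ {weight l} skip)) ⟩
      (if g then 0ˢ else X ⊛ row f false R) ⊕ (X ⊛ row f true R ⊕ weight l ⊛ row f false R)
        ≈⟨ row-letter f g l R ⟨
      row f g (letter l · R) ∎
      where
      open SetoidReasoning S.setoid
      first : ∀ g → chosen f g Fin.zero ≗ (if g then 0ˢ else X ⊛ row f false R)
      first true  = chosen-excluded {f} {true} Fin.zero (λ (_ , ¬b) → ¬b (refl , toℕ-c , refl))
      first false = S.trans
        (chosen-allowed {f} {f} {false} {false} Fin.zero ((λ { (_ , _ , ()) }) , (λ { (() , _) }))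
            (unchanged Fin.zero) (mk⇔ (λ ()) (λ ())))
        (S.*-congˡ {X} skip)

  gen-chain : ∀ f g i n → suc (suc i) + n ≡ α →
    genA f g (suc i) (block (suc i) (suc n)) ≗ row f g (prod (ext w) (suc i) (suc n))
  gen-chain f g i zero eq = gen-row f g (start f) (second f)
    where
    open LaterStep i zero eq
    start : ∀ f → 1ˢ ≗ row f false Id
    start true  n = sym (+-identityʳ (1ˢ n))
    start false n = sym (+-identityʳ (1ˢ n))
    -- In the last clique y is adjacent to x₀. If f is true it is excluded, in agreement with the
    -- entry 0 of `Id` in the lower left corner.
    second : ∀ f → chosen f g (Fin.suc Fin.zero) ≗ X ⊛ row f true Id
    second true  = S.trans
      (chosen-excluded {true} {g} (Fin.suc Fin.zero)
          (λ (¬a , _) → ¬a (refl , trans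
              (cong suc (trans toℕ-c (sym (+-identityʳ (suc i))))) eq , refl)))
      (S.sym (S.zeroʳ X))
    second false = chosen-allowed {false} {false} {g} {true} (Fin.suc Fin.zero)
      ((λ { (() , _) }) , (λ { (_ , _ , ()) })) (unchanged (Fin.suc Fin.zero))
          (mk⇔ (λ _ → refl) (λ _ → refl))
  gen-chain f g i (suc n) eq = gen-row f g (gen-chain f false (suc i) n eq′)
    (S.trans
      (chosen-allowed {f} {f} {g} {true} (Fin.suc Fin.zero)
        ((λ (_ , last , _) → <-irrefl last
            (subst₂ _<_ (cong suc (sym toℕ-c)) eq (m<m+n (suc (suc i)) z<s))) , (λ { (_ , _ , ()) }))
        (unchanged (Fin.suc Fin.zero)) (mk⇔ (λ _ → refl) (λ _ → refl)))
      (S.*-congˡ {X} (gen-chain f true (suc i) n eq′)))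
    where
    open LaterStep i (suc n) eq
    eq′ : suc (suc (suc i)) + n ≡ α
    eq′ = trans (cong (suc ∘ suc) (sym (+-suc i n))) eq

  -- Only the first clique can set f. After x₀ just the entry e₁₁ of the remaining product survives;
  -- after y₀ its whole second row counts, and after neither its whole first row. With their factors
  -- these add up to the trace.
  gen-cycle : ∀ n → suc (suc n) ≡ α →
    genA false false 0 (block 0 (suc (suc n))) ≗ tr (prod (ext w) 0 (suc (suc n)))
  gen-cycle n eq = begin
    genA false false 0 (block 0 (suc (suc n)))
      ≈⟨ gen-step false false ⟩
    chosen false false Fin.zero ⊕ (chosen false false
        (Fin.suc Fin.zero) ⊕ weight l ⊛ genA false false 1 L)
      ≈⟨ S.+-cong
           (chosen-allowed {false} {true} {false} {false} Fin.zero
             ((λ { (() , _) }) , (λ { (() , _) })) (mk⇔ (λ _ → inj₂ (refl , refl)) (λ _ → refl))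
                 (mk⇔ (λ ()) (λ ())))
           (S.+-congʳ (chosen-allowed {false} {false} {false} {true} (Fin.suc Fin.zero)
             ((λ { (() , _) }) , (λ { (() , _) })) (mk⇔ inj₁ (λ { (inj₁ e) → e ; (inj₂ (() , _)) }))
                 (mk⇔ (λ _ → refl) (λ _ → refl)))) ⟩
    X ⊛ genA true false 1 L ⊕ (X ⊛ genA false true 1 L ⊕ weight l ⊛ genA false false 1 L)
      ≈⟨ S.+-cong (S.*-congˡ {X} (chain true false))
          (S.+-cong (S.*-congˡ {X} (chain false true)) (S.*-congˡ {weight l} (chain false false))) ⟩
    X ⊛ (e₁₁ R ⊕ 0ˢ) ⊕ (X ⊛ (e₂₁ R ⊕ e₂₂ R) ⊕ weight l ⊛ (e₁₁ R ⊕ e₁₂ R))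
      ≈⟨ solve 6 (λ s x a b c d → x :* (a :+ con 0) :+ (x :* (c :+ d) :+ s :* (a :+ b)) :=
          (s :+ x) :* a :+ x :* c :+ (s :* b :+ x :* d))
           S.refl (weight l) X (e₁₁ R) (e₁₂ R) (e₂₁ R) (e₂₂ R) ⟩
    tr (prod (ext w) 0 (suc (suc n))) ∎
    where
    open SetoidReasoning S.setoid
    open Step 0 (suc n) eq
    l = toℕ (lookup w c)
    R = prod (ext w) 1 (suc n)
    chain : ∀ f g → genA f g 1 L ≗ row f g R
    chain f g = gen-chain f g 0 n eq

  indepCount≡tr : 2 ≤ α → ∀ j → indepCount G j ≡ tr (prod (ext w) 0 α) j
  indepCount≡tr 2≤α j = begin
    indepCount G j                           ≡⟨ indepCount≡gen G j ⟩
    gen G (λ _ → yes tt) (cliques q w) j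
      ≡⟨ gen-cong G (λ _ → yes tt) (allowed? false false 0)
          (All.universal (λ _ → mk⇔ (λ _ → (λ { (() , _) }) , (λ { (() , _) })) _) (cliques q w)) j ⟩
    genA false false 0 (cliques q w) j
      ≡⟨ cong (λ is → genA false false 0 (concat (map (clique q w) is)) j) (allFin≡fins α) ⟩
    genA false false 0 (block 0 α) j         ≡⟨ cong (λ n → genA false false 0 (block 0 n) j) (sym eq) ⟩
    genA false false 0 (block 0 (suc (suc (α ∸ 2)))) j
                                             ≡⟨ gen-cycle (α ∸ 2) eq j ⟩
    tr (prod (ext w) 0 (suc (suc (α ∸ 2)))) j ≡⟨ cong (λ n → tr (prod (ext w) 0 n) j) eq ⟩
    tr (prod (ext w) 0 α) j                  ∎
    where
    open ≡-Reasoning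
    eq : suc (suc (α ∸ 2)) ≡ α
    eq = m+[n∸m]≡n 2≤α

  length-block : ∀ i n → length (block i n) ≡ n * q + win (ext w) i n
  length-block i zero    = refl
  length-block i (suc n) = begin
    length (clique q w (i mod α) ++ block (suc i) n)
      ≡⟨ List.length-++ (clique q w (i mod α)) ⟩
    length (clique q w (i mod α)) + length (block (suc i) n)
      ≡⟨ cong₂ _+_ (trans (List.length-map (i mod α ,_) (allFin (cliqueSize q w (i mod α))))
          (List.length-tabulate {n = cliqueSize q w (i mod α)} id)) (length-block (suc i) n) ⟩
    q + ext w i + (n * q + win (ext w) (suc i) n)
      ≡⟨ interchange q (ext w i) (n * q) (win (ext w) (suc i) n) ⟩
    suc n * q + win (ext w) i (suc n) ∎
    where open ≡-Reasoning

  -- The number of vertices depends on w only through its number of ones, so the lists `I` for w and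
  -- for b have equal length.
  length-cliques : length (cliques q w) ≡ α * q + ones w
  length-cliques = trans (cong (λ is → length (concat (map (clique q w) is))) (allFin≡fins α))
    (trans (length-block 0 α) (cong (α * q +_) (sym (ones-win w))))

-- Factors of least imbalance length

module LeastImbalance {α : ℕ} .{{_ : NonZero α}} (v : Word α) (r d : ℕ) (d<α : d < α)
  (near : ∀ s → s < r → ∀ i j → win (ext v) i s ≤ suc (win (ext v) j s))
  (far : 2 + win (ext v) d r ≤ win (ext v) 0 r) where

  private
    f = ext v

  -- Removing the common part leaves two factors of length c.
  overlapping : ∀ i c → c < r → win f i r ≤ suc (win f (i + c) r) × win f (i + c) r ≤ suc (win f i r)
  overlapping i c c<r = subst₂ _≤_ (sym head) (cong suc (sym tail)) (bound i (i + c + (r ∸ c)))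
                  , subst₂ _≤_ (sym tail) (cong suc (sym head)) (bound (i + c + (r ∸ c)) i)
    where
    head : win f i r ≡ win f (i + c) (r ∸ c) + win f i c
    head = trans (cong (win f i) (sym (m+[n∸m]≡n (<⇒≤ c<r))))
        (trans (win-+ f i c (r ∸ c)) (+-comm (win f i c) _))
    tail : win f (i + c) r ≡ win f (i + c) (r ∸ c) + win f (i + c + (r ∸ c)) c
    tail = trans (cong (win f (i + c)) (sym (m∸n+n≡m (<⇒≤ c<r)))) (win-+ f (i + c) (r ∸ c) c)
    bound : ∀ j k → win f (i + c) (r ∸ c) + win f j c ≤ suc (win f (i + c) (r ∸ c) + win f k c)
    bound j k = ≤-trans (+-monoʳ-≤ (win f (i + c) (r ∸ c)) (near c c<r j k))
        (≤-reflexive (+-suc _ (win f k c)))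

  ¬close : ¬ (win f 0 r ≤ suc (win f d r))
  ¬close le = <-irrefl refl (≤-trans far le)

  r≤d : r ≤ d
  r≤d = ≮⇒≥ λ d<r → ¬close (proj₁ (overlapping 0 d d<r))

  -- The factor at 0 recurs at α, at distance α - d from the one at d, so an overlap around the end
  -- of the period is excluded in the same way.
  d+r≤α : d + r ≤ α
  d+r≤α = subst (_≤ α) (+-comm r d) (≤-trans (+-monoˡ-≤ d r≤α∸d) (≤-reflexive (m∸n+n≡m (<⇒≤ d<α))))
    where
    r≤α∸d : r ≤ α ∸ d
    r≤α∸d = ≮⇒≥ λ α∸d<r → ¬close (subst (_≤ suc (win f d r))
      (trans (cong (λ i → win f i r) (m+[n∸m]≡n (<⇒≤ d<α))) (win-periodic v 0 r))
          (proj₂ (overlapping d (α ∸ d) α∸d<r)))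

  -- The difference of at least two is shared between a prefix and the complementary suffix. Both
  -- are shorter than r and contribute at most one, hence exactly one each.
  prefix : ∀ k l → suc k + suc l ≡ r → win f 0 (suc k) ≡ suc (win f d (suc k))
  prefix k l refl = ≤-antisym (near (suc k) (m<m+n (suc k) z<s) 0 d)
      (+-cancelʳ-≤ (suc (win f (d + suc k) (suc l))) _ _ (begin
    suc (win f d (suc k)) + suc (win f (d + suc k) (suc l))     ≡⟨ cong suc (+-suc _ _) ⟩
    2 + (win f d (suc k) + win f (d + suc k) (suc l))
      ≡⟨ cong (2 +_) (win-+ f d (suc k) (suc l)) ⟨
    2 + win f d r                                               ≤⟨ far ⟩
    win f 0 r                                                   ≡⟨ win-+ f 0 (suc k) (suc l) ⟩
    win f 0 (suc k) + win f (suc k) (suc l)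
      ≤⟨ +-monoʳ-≤ (win f 0 (suc k)) (near (suc l) (m<n+m (suc l) z<s) (suc k) (d + suc k)) ⟩
    win f 0 (suc k) + suc (win f (d + suc k) (suc l))           ∎))
    where open ≤-Reasoning

  suffix : ∀ k l → suc k + suc l ≡ r → win f (suc k) (suc l) ≡ suc (win f (d + suc k) (suc l))
  suffix k l refl = ≤-antisym (near (suc l) (m<n+m (suc l) z<s) (suc k) (d + suc k))
      (+-cancelˡ-≤ (suc (win f d (suc k))) _ _ (begin
    suc (win f d (suc k)) + suc (win f (d + suc k) (suc l))     ≡⟨ cong suc (+-suc _ _) ⟩
    2 + (win f d (suc k) + win f (d + suc k) (suc l))
      ≡⟨ cong (2 +_) (win-+ f d (suc k) (suc l)) ⟨
    2 + win f d r                                               ≤⟨ far ⟩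
    win f 0 r                                                   ≡⟨ win-+ f 0 (suc k) (suc l) ⟩
    win f 0 (suc k) + win f (suc k) (suc l)
      ≡⟨ cong (_+ win f (suc k) (suc l)) (prefix k l refl) ⟩
    suc (win f d (suc k)) + win f (suc k) (suc l)               ∎))
    where open ≤-Reasoning

  -- A prefix of 1p1 has one more one than the suffix of 0p0 of the same length;
  -- hence p is a palindrome.
  reflected-prefix : ∀ k l → suc k + suc l ≡ r → win f 0 (suc k) ≡ suc (win f (d + suc l) (suc k))
  reflected-prefix k l eq = ≤-antisym
      (near (suc k) (subst (suc k <_) eq (m<m+n (suc k) z<s)) 0 (d + suc l)) (begin
    suc (win f (d + suc l) (suc k))    ≡⟨ suffix l k (trans (+-comm (suc l) (suc k)) eq) ⟨
    win f (suc l) (suc k)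
      ≤⟨ near (suc k) (subst (suc k <_) eq (m<m+n (suc k) z<s)) (suc l) d ⟩
    suc (win f d (suc k))              ≡⟨ prefix k l eq ⟨
    win f 0 (suc k)                    ∎)
    where open ≤-Reasoning

≡suc⇒letters : ∀ {x y} → x ≤ 1 → x + 0 ≡ suc (y + 0) → x ≡ 1 × y ≡ 0
≡suc⇒letters {y = zero}  x≤1 eq = trans (sym (+-identityʳ _)) eq , refl
≡suc⇒letters {y = suc y} x≤1 eq = contradiction (subst (_≤ 1) (trans (sym (+-identityʳ _)) eq) x≤1)
    (λ { (s≤s ()) })

2≤least : ∀ {α} .{{_ : NonZero α}} (v : Word α) d r → 2 + win (ext v) d r ≤ win (ext v) 0 r → ∃ λ m →
  r ≡ suc (suc m)
2≤least v d zero ()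
2≤least v d (suc zero) far = contradiction
    (≤-trans far (≤-trans (≤-reflexive (+-identityʳ _)) (ext≤1 v 0))) (λ { (s≤s ()) })
2≤least v d (suc (suc m)) far = m , refl

-- Reflecting the block between the outer letters

module Reflection {α : ℕ} .{{_ : NonZero α}} (v : Word α) (m d : ℕ) (d<α : d < α)
  (near : ∀ s → s < 2 + m → ∀ i j → win (ext v) i s ≤ suc (win (ext v) j s))
  (far : 2 + win (ext v) d (2 + m) ≤ win (ext v) 0 (2 + m)) where

  private
    r = 2 + m
    f = ext v

  open LeastImbalance v r d d<α near far

  e b : ℕ
  e = suc (d + m)
  b = α ∸ (d + r)

  e+1+b≡α : e + suc b ≡ α
  e+1+b≡α = trans (+-suc e b) (trans
      (cong (_+ b) (sym (trans (+-suc d (suc m)) (cong suc (+-suc d m))))) (m+[n∸m]≡n d+r≤α))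

  e<α : e < α
  e<α = subst (e <_) e+1+b≡α (m<m+n e z<s)

  f[0]f[d] : f 0 ≡ 1 × f d ≡ 0
  f[0]f[d] = ≡suc⇒letters (ext≤1 v 0) (prefix 0 m refl)

  f[e] : f e ≡ 0
  f[e] = trans (cong f (sym (+-suc d m))) (proj₂ (≡suc⇒letters (ext≤1 v 0) (reflected-prefix 0 m refl)))

  f[m+1] : f (suc m) ≡ 1
  f[m+1] = proj₁ (≡suc⇒letters (ext≤1 v (suc m)) (suffix m 0 (+-comm (suc m) 1)))

  -- Subtracting `reflected-prefix` for the lengths k + 1 and k + 2 leaves a letter of the first p
  -- on one side and its mirror image in the second p on the other.
  mirror : ∀ k l → k < m → suc k + l ≡ e → f (suc k) ≡ f l
  mirror k l k<m eq = +-cancelˡ-≡ (win f 0 (suc k)) _ _ (begin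
    win f 0 (suc k) + f (suc k)             ≡⟨ win-∷ʳ f 0 (suc k) ⟨
    win f 0 (suc (suc k))
      ≡⟨ reflected-prefix (suc k) t (trans (cong suc (+-suc (suc k) t)) (cong suc k+t)) ⟩
    suc (win f (d + suc t) (suc (suc k)))
      ≡⟨ cong suc (+-comm (f (d + suc t)) (win f (suc (d + suc t)) (suc k))) ⟩
    suc (win f (suc (d + suc t)) (suc k)) + f (d + suc t)
      ≡⟨ cong₂ (λ i j → suc (win f i (suc k)) + f j) (sym (+-suc d (suc t))) d+t ⟩
    suc (win f (d + suc (suc t)) (suc k)) + f l
      ≡⟨ cong (_+ f l) (reflected-prefix k (suc t)
          (trans (+-suc (suc k) (suc t)) (cong suc (trans (+-suc (suc k) t) k+t)))) ⟨
    win f 0 (suc k) + f l                   ∎)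
    where
    open ≡-Reasoning
    t = m ∸ suc k
    k+t : suc (suc k + t) ≡ suc m
    k+t = cong suc (m+[n∸m]≡n k<m)
    d+t : d + suc t ≡ l
    d+t = +-cancelˡ-≡ (suc k) _ _ (trans (shuffle k d t)
        (trans (cong (d +_) k+t) (trans (+-suc d m) (sym eq))))
      where
      shuffle : ∀ k d t → suc k + (d + suc t) ≡ d + suc (suc k + t)
      shuffle = solve-∀

  -- The positions from 1 to e - 1 carry p1X0p; the 1 before them and the 0Y after them stay in
  -- place.
  reflect : ℕ → Fin 2
  reflect zero    = lookup v (0 mod α)
  reflect (suc k) = lookup v ((if does (suc k <? e) then e ∸ suc k else suc k) mod α)

  v′ : Word α
  v′ = tabulate (reflect ∘ toℕ)

  private
    g = ext v′

  g[0] : g 0 ≡ f 0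
  g[0] = ext-tabulate reflect (≤-<-trans z≤n d<α)

  reflected : ∀ k l → suc k + suc l ≡ e → g (suc k) ≡ f (suc l)
  reflected k l eq = trans (ext-tabulate reflect (<-trans k<e e<α)) (cong f (trans
    (cong (if_then e ∸ suc k else suc k) (dec-true (suc k <? e) k<e))
    (trans (cong (_∸ suc k) (sym eq)) (m+n∸m≡n (suc k) (suc l)))))
    where
    k<e : suc k < e
    k<e = subst (suc k <_) eq (m<m+n (suc k) z<s)

  unchanged : ∀ k → k < suc b → g (e + k) ≡ f (e + k)
  unchanged k k<1+b = trans (ext-tabulate reflect (subst (e + k <_) e+1+b≡α (+-monoʳ-< e k<1+b)))
    (cong (λ b → f (if b then e ∸ (e + k) else (e + k))) (dec-false (e + k <? e) (≤⇒≯ (m≤m+n e k))))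

  swap : ∀ q′ → Products.Swap q′ f g m (d ∸ r) b d e
  swap q′ = record
    { d≡        = sym (m+[n∸m]≡n r≤d)
    ; e≡        = refl
    ; f[0]      = proj₁ f[0]f[d]
    ; f[m+1]    = f[m+1]
    ; f[d]      = proj₂ f[0]f[d]
    ; f[e]      = f[e]
    ; mirror    = mirror
    ; g[0]      = g[0]
    ; reflected = reflected
    ; unchanged = unchanged
    }

  ones-v′ : ones v′ ≡ ones v
  ones-v′ = begin
    ones v′                                     ≡⟨ ones-win v′ ⟩
    win g 0 α                                   ≡⟨ cong (win g 0) e+1+b≡α ⟨
    g 0 + win g 1 (d + m + suc b)               ≡⟨ cong (g 0 +_) (win-+ g 1 (d + m) (suc b)) ⟩
    g 0 + (win g 1 (d + m) + win g e (suc b))   ≡⟨ cong₂ _+_ g[0] (cong₂ _+_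
      (win-reverse 1 1 (d + m) λ k l kl → reflected k l (cong suc (trans (+-suc k l) kl)))
      (win-cong (suc b) unchanged)) ⟩
    f 0 + (win f 1 (d + m) + win f e (suc b))   ≡⟨ cong (f 0 +_) (win-+ f 1 (d + m) (suc b)) ⟨
    f 0 + win f 1 (d + m + suc b)               ≡⟨ cong (win f 0) e+1+b≡α ⟩
    win f 0 α                                   ≡⟨ ones-win v ⟨
    ones v                                      ∎
    where open ≡-Reasoning

  -- By `mirror`, the reflection exchanges the two copies of p without altering a letter, so a
  -- change can occur only from position m + 1 to position d.
  same-low : ∀ k → k < suc m → g k ≡ f k
  same-low zero    _         = g[0]
  same-low (suc k) (s≤s k<m) = trans (reflected k l eq) (sym (mirror k (suc l) k<m eq))
    where
    l = d + m ∸ suc k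
    eq : suc k + suc l ≡ e
    eq = trans (+-suc (suc k) l) (cong suc (m+[n∸m]≡n (≤-trans k<m (m≤n+m m d))))

  same-middle : ∀ k → d < k → k < α → g k ≡ f k
  same-middle (suc k) (s≤s d≤k) k<α with suc k <? e
  ... | no e≰k = subst (λ i → g i ≡ f i) (m+[n∸m]≡n (≮⇒≥ e≰k))
        (unchanged (suc k ∸ e) (+-cancelˡ-< e _ _
            (subst₂ _<_ (sym (m+[n∸m]≡n (≮⇒≥ e≰k))) (sym e+1+b≡α) k<α)))
  ... | yes (s≤s k<e) = trans (reflected k l eq)
      (mirror l (suc k) l<m (trans (+-comm (suc l) (suc k)) eq))
    where
    l = d + m ∸ suc k
    eq : suc k + suc l ≡ e
    eq = trans (+-suc (suc k) l) (cong suc (m+[n∸m]≡n k<e))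
    l<m : l < m
    l<m = +-cancelˡ-< k _ _ (≤-trans (≤-reflexive (m+[n∸m]≡n k<e)) (+-monoˡ-≤ m d≤k))

  same : ∀ k → d < k → k < α + suc m → g k ≡ f k
  same k d<k k< with k <? α
  ... | yes k<α = same-middle k d<k k<α
  ... | no  k≮α = begin
    g k              ≡⟨ cong g eq ⟨
    g (k ∸ α + α)    ≡⟨ ext-periodic v′ (k ∸ α) ⟩
    g (k ∸ α)
      ≡⟨ same-low (k ∸ α) (+-cancelʳ-< α _ _ (subst₂ _<_ (sym eq) (+-comm α (suc m)) k<)) ⟩
    f (k ∸ α)        ≡⟨ ext-periodic v (k ∸ α) ⟨
    f (k ∸ α + α)    ≡⟨ cong f eq ⟩
    f k              ∎
    where
    open ≡-Reasoning
    eq = m∸n+n≡m (≮⇒≥ k≮α)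

  -- A factor starting at 0 is a prefix of 1p. One starting later either lies inside the reflected
  -- block, and is a reversed factor of v, or starts behind d. In the latter case it ends before α +
  -- m + 1, so it meets no changed letter even after wrapping around into 1p.
  win-v′ : ∀ s → s < r → ∀ j → j < α → ∃ λ i → win g j s ≡ win f i s
  win-v′ s (s≤s s≤1+m) zero _ = 0 , win-cong s λ k k<s → same-low k (<-≤-trans k<s s≤1+m)
  win-v′ s (s≤s s≤1+m) (suc j) j<α with suc j + s ≤? e
  ... | yes in-range = suc t , win-reverse (suc t) (suc j) s λ k l kl →
        reflected (j + k) (t + l) (trans (shuffle j k t l)
            (trans (cong (λ n → suc j + n + t) kl) (m+[n∸m]≡n in-range)))
    where
    t = e ∸ (suc j + s)
    shuffle : ∀ j k t l → suc (j + k) + suc (t + l) ≡ suc j + suc (k + l) + t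
    shuffle = solve-∀
  ... | no out-of-range = suc j , win-cong s λ k k<s → same (suc j + k)
        (<-≤-trans d<1+j (m≤m+n (suc j) k))
        (+-mono-≤ j<α (≤-trans (<⇒≤ k<s) s≤1+m))
    where
    d<1+j : d < suc j
    d<1+j = +-cancelʳ-< (suc m) _ _
        (≤-trans (≤-reflexive (cong suc (+-suc d m)))
            (≤-trans (≰⇒> out-of-range) (+-monoʳ-≤ (suc j) s≤1+m)))

  near-v′ : ∀ s → s < r → ¬ ImbalancedAt v′ s
  near-v′ s s<r (i , j , le) = contradiction
    (≤suc⇒∣-∣≤1 (near s s<r (proj₁ (at i)) (proj₁ (at j))) (near s s<r (proj₁ (at j)) (proj₁ (at i))))
    (<⇒≱ (subst (2 ≤_) (trans (gap-factor v′ s i j) (cong₂ ∣_-_∣ (proj₂ (at i)) (proj₂ (at j)))) le))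
    where
    at : ∀ i → ∃ λ i′ → win g i s ≡ win f i′ s
    at i = let (i′ , eq) = win-v′ s s<r (i % α) (m%n<n i α) in i′ , trans (sym (win-% v′ i s)) eq

imbalancedAt-factor : ∀ {α} .{{_ : NonZero α}} (w : Word α) i r → ImbalancedAt (factor w i α) r →
  ImbalancedAt w r
imbalancedAt-factor {α} w i r (j , k , le) = i + j , i + k , subst (2 ≤_)
  (trans (gap-factor (factor w i α) r j k)
    (trans (cong₂ ∣_-_∣ (win-factor w i j r) (win-factor w i k r))
        (sym (gap-factor w r (i + j) (i + k))))) le

-- Comparison with the balanced word

module _ {α : ℕ} .{{_ : NonZero α}} (q′ : ℕ) where
  open Products q′

  trace : Word α → Series
  trace w = tr (prod (ext w) 0 α)

  trace-factor : ∀ w i → trace (factor w i α) ≗ trace w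
  trace-factor w i = S.trans
    (λ n → cong (λ M → tr M n) (prod-cong α λ k _ → ext-factor w i k))
    (rotate i α refl)
    where
    rotate : ∀ i n → n ≡ α → tr (prod (ext w) i n) ≗ tr (prod (ext w) 0 n)
    rotate zero    n       eq = S.refl
    rotate (suc i) zero    eq = S.refl
    rotate (suc i) (suc n) eq = S.trans
      (tr-prod-rotate (ext w) i n (trans (cong (λ l → ext w (i + l)) eq) (ext-periodic w i)))
      (rotate i (suc n) eq)

  -- `degree` is |X| + |Y|; by `length≡`, positivity of `gain` up to it covers exactly the range 2r
  -- ≤ j ≤ α.
  record Improvement (w : Word α) (r : ℕ) (w′ : Word α) : Set where
    field
      ones≡    : ones w′ ≡ ones w
      near     : ∀ s → s < r → ¬ ImbalancedAt w′ s
      degree   : ℕ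
      gain     : Series
      length≡  : r * 2 + degree ≡ α
      positive : PositiveUpTo degree gain
      trace≡   : trace w′ ≗ trace w ⊕ X^ (r * 2) ⊛ gain

  improve-rotated : ∀ v m d → d < α → (∀ s → s < 2 + m → ¬ ImbalancedAt v s) →
    2 + win (ext v) d (2 + m) ≤ win (ext v) 0 (2 + m) → ∃ (Improvement v (2 + m))
  improve-rotated v m d d<α below far = v′ , record
    { ones≡    = ones-v′
    ; near     = near-v′
    ; degree   = d ∸ r + b
    ; gain     = proj₁ swapped
    ; length≡  = length≡
    ; positive = proj₁ (proj₂ swapped)
    ; trace≡   = subst (λ n → tr (prod (ext v′) 0 n) ≗ tr (prod (ext v) 0 n) ⊕ X^
        (r * 2) ⊛ proj₁ swapped)
                   e+1+b≡α (proj₂ (proj₂ swapped))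
    }
    where
    r = 2 + m
    near : ∀ s → s < r → ∀ i j → win (ext v) i s ≤ suc (win (ext v) j s)
    near s s<r = ¬imbalanced-win v s (below s s<r)
    open LeastImbalance v r d d<α near far
    open Reflection v m d d<α near far
    swapped = tr-swap (swap q′)
    length≡ : r * 2 + (d ∸ r + b) ≡ α
    length≡ = begin
      r * 2 + (d ∸ r + b)     ≡⟨ shuffle r (d ∸ r) b ⟩
      r + (d ∸ r) + r + b     ≡⟨ cong (λ d → d + r + b) (m+[n∸m]≡n r≤d) ⟩
      d + r + b               ≡⟨ m+[n∸m]≡n d+r≤α ⟩
      α                       ∎
      where
      open ≡-Reasoning
      shuffle : ∀ r a b → r * 2 + (a + b) ≡ r + a + r + b
      shuffle = solve-∀

  improve-at : ∀ w r i j → (∀ s → s < r → ¬ ImbalancedAt w s) → 2 + win (ext w) j r ≤ win (ext w) i r →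
    ∃ (Improvement w r)
  improve-at w r i j below far = finish (2≤least v (d₀ % α) r far′)
    where
    v = factor w i α
    -- A representative of j - i modulo α that needs no subtraction.
    d₀ = j + pred α * i
    i+d₀ : i + d₀ ≡ j + i * α
    i+d₀ = trans (shuffle i j (pred α)) (cong (λ n → j + i * n) (suc-pred α))
      where
      shuffle : ∀ i j p → i + (j + p * i) ≡ j + i * suc p
      shuffle = solve-∀
    far′ : 2 + win (ext v) (d₀ % α) r ≤ win (ext v) 0 r
    far′ = subst₂ (λ x y → 2 + x ≤ y)
      (begin
        win (ext w) j r                  ≡⟨ win-% w j r ⟨
        win (ext w) (j % α) r            ≡⟨ cong (λ k → win (ext w) k r) ([m+kn]%n≡m%n j i α) ⟨
        win (ext w) ((j + i * α) % α) r  ≡⟨ win-% w (j + i * α) r ⟩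
        win (ext w) (j + i * α) r        ≡⟨ cong (λ k → win (ext w) k r) i+d₀ ⟨
        win (ext w) (i + d₀) r           ≡⟨ win-factor w i d₀ r ⟨
        win (ext v) d₀ r                 ≡⟨ win-% v d₀ r ⟨
        win (ext v) (d₀ % α) r           ∎)
      (trans (cong (λ k → win (ext w) k r) (sym (+-identityʳ i))) (sym (win-factor w i 0 r)))
      far
      where open ≡-Reasoning
    finish : (∃ λ m → r ≡ suc (suc m)) → ∃ (Improvement w r)
    finish (m , refl) =
      let (w′ , imp) = improve-rotated v m (d₀ % α) (m%n<n d₀ α)
                  (λ s s<r → below s s<r ∘ imbalancedAt-factor w i s) far′
          open Improvement imp
      in w′ , record
        { ones≡    = trans ones≡ ones-v
        ; near     = near
        ; degree   = degree
        ; gain     = gain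
        ; length≡  = length≡
        ; positive = positive
        ; trace≡   = S.trans trace≡ (S.+-congʳ (trace-factor w i))
        }
      where
      ones-v : ones v ≡ ones w
      ones-v = trans (ones-win v) (trans (win-factor w i 0 α) (win-period w (i + 0)))

  improve : ∀ w r → IsLeastImbalanceLength w r → ∃ (Improvement w r)
  improve w r ((i , j , le) , below) with ≤-total (win (ext w) i r) (win (ext w) j r)
  ... | inj₁ i≤j = improve-at w r j i below (subst (2 + win (ext w) i r ≤_) (m∸n+n≡m i≤j)
        (+-monoˡ-≤ _ (subst (2 ≤_) (trans (gap-factor w r i j) (m≤n⇒∣m-n∣≡n∸m i≤j)) le)))
  ... | inj₂ j≤i = improve-at w r i j below (subst (2 + win (ext w) j r ≤_) (m∸n+n≡m j≤i)
        (+-monoˡ-≤ _ (subst (2 ≤_) (trans (gap-factor w r i j) (m≤n⇒∣n-m∣≡n∸m j≤i)) le)))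

-- Coefficients of independence polynomials

coeff-applyUpTo-< : ∀ (h : ℕ → ℤ) n {j} → j < n → coeff (applyUpTo h n) j ≡ h j
coeff-applyUpTo-< h (suc n) {zero}  _         = refl
coeff-applyUpTo-< h (suc n) {suc j} (s≤s j<n) = coeff-applyUpTo-< (h ∘ suc) n j<n

coeff-applyUpTo-≥ : ∀ (h : ℕ → ℤ) n {j} → n ≤ j → coeff (applyUpTo h n) j ≡ 0ℤ
coeff-applyUpTo-≥ h zero            _         = refl
coeff-applyUpTo-≥ h (suc n) {suc j} (s≤s n≤j) = coeff-applyUpTo-≥ (h ∘ suc) n n≤j

module _ (G : Graph) where
  private
    N = length (Graph.vertices G)

  coeff-I : ∀ {j} → j ≤ N → coeff (I G) j ≡ ℤ.+ indepCount G j
  coeff-I {j} j≤N = trans (cong (λ f → coeff f j) (List.map-upTo (λ j → ℤ.+ indepCount G j) (suc N)))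
    (coeff-applyUpTo-< (λ j → ℤ.+ indepCount G j) (suc N) (s≤s j≤N))

  coeff-I-high : ∀ {j} → N < j → coeff (I G) j ≡ 0ℤ
  coeff-I-high {j} N<j = trans (cong (λ f → coeff f j)
      (List.map-upTo (λ j → ℤ.+ indepCount G j) (suc N)))
    (coeff-applyUpTo-≥ (λ j → ℤ.+ indepCount G j) (suc N) N<j)

module _ {G H : Graph} (length≡ : length (Graph.vertices G) ≡ length (Graph.vertices H)) where

  indepCount-≤⇒⪯cf : (∀ j → indepCount G j ≤ indepCount H j) → I G ⪯cf I H
  indepCount-≤⇒⪯cf le j with j ≤? length (Graph.vertices G)
  ... | yes j≤ = subst₂ ℤ._≤_ (sym (coeff-I G j≤)) (sym (coeff-I H (subst (j ≤_) length≡ j≤)))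
      (ℤ.+≤+ (le j))
  ... | no  j≰ = ℤ.≤-reflexive (trans (coeff-I-high G (≰⇒> j≰))
      (sym (coeff-I-high H (subst (_< j) length≡ (≰⇒> j≰)))))

  indepCount-≡⇒≈ : (∀ j → indepCount G j ≡ indepCount H j) → I G ≈ I H
  indepCount-≡⇒≈ eq j with j ≤? length (Graph.vertices G)
  ... | yes j≤ = trans (coeff-I G j≤)
      (trans (cong ℤ.+_ (eq j)) (sym (coeff-I H (subst (j ≤_) length≡ j≤))))
  ... | no  j≰ = trans (coeff-I-high G (≰⇒> j≰)) (sym (coeff-I-high H (subst (_< j) length≡ (≰⇒> j≰))))

  ≈⇒indepCount-≡ : I G ≈ I H → ∀ {j} → j ≤ length (Graph.vertices G) → indepCount G j ≡ indepCount H j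
  ≈⇒indepCount-≡ eq {j} j≤ = ℤ.+-injective
    (trans (sym (coeff-I G j≤)) (trans (eq j) (coeff-I H (subst (j ≤_) length≡ j≤))))

-- Iterating the improvement

module Comparison {α : ℕ} .{{_ : NonZero α}} (q′ ρ : ℕ) (2≤α : 2 ≤ α) (ρ<α : ρ < α) where

  private
    q = suc (suc q′)
    b = balancedWord α ρ ρ<α

  count : Word α → ℕ → ℕ
  count w = indepCount (C q w)

  count≡trace : ∀ w j → count w j ≡ trace q′ w j
  count≡trace w = Chain.indepCount≡tr q′ w 2≤α

  module _ {w r w′} (imp : Improvement q′ w r w′) where
    open Improvement imp

    count≡ : ∀ j → count w′ j ≡ count w j + (X^ (r * 2) ⊛ gain) j
    count≡ j = begin
      count w′ j                                 ≡⟨ count≡trace w′ j ⟩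
      trace q′ w′ j                              ≡⟨ trace≡ j ⟩
      trace q′ w j + (X^ (r * 2) ⊛ gain) j
        ≡⟨ cong (λ c → c + (X^ (r * 2) ⊛ gain) j) (count≡trace w j) ⟨
      count w j + (X^ (r * 2) ⊛ gain) j          ∎
      where open ≡-Reasoning

    improvement-≤ : ∀ j → count w j ≤ count w′ j
    improvement-≤ j = ≤-trans (m≤m+n (count w j) _) (≤-reflexive (sym (count≡ j)))

    improvement-≡ : ∀ j → j < 2 * r → count w j ≡ count w′ j
    improvement-≡ j j<2r = begin
      count w j                             ≡⟨ +-identityʳ (count w j) ⟨
      count w j + 0
        ≡⟨ cong (λ c → count w j + c) (X^-low (r * 2) gain j (subst (j <_) (*-comm 2 r) j<2r)) ⟨
      count w j + (X^ (r * 2) ⊛ gain) j     ≡⟨ count≡ j ⟨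
      count w′ j                            ∎
      where open ≡-Reasoning

    improvement-< : ∀ j → 2 * r ≤ j → j ≤ α → count w j < count w′ j
    improvement-< j 2r≤j j≤α = <-≤-trans
      (m<m+n (count w j) (subst (0 <_)
          (trans (sym (X^-high (r * 2) gain k)) (cong (X^ (r * 2) ⊛ gain) j≡)) (positive k k≤n)))
      (≤-reflexive (sym (count≡ j)))
      where
      k = j ∸ r * 2
      j≡ : r * 2 + k ≡ j
      j≡ = m+[n∸m]≡n (subst (_≤ j) (*-comm 2 r) 2r≤j)
      k≤n : k ≤ degree
      k≤n = +-cancelˡ-≤ (r * 2) _ _ (subst₂ _≤_ (sym j≡) (sym length≡) j≤α)

    -- Places j = α in the strict range whatever r is, so that i_α can serve both as the measure of
    -- progress and as the test for balance.
    improvement⇒2r≤α : 2 * r ≤ α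
    improvement⇒2r≤α = subst₂ _≤_ (*-comm r 2) length≡ (m≤m+n (r * 2) degree)

  count-factor : ∀ w i j → count (factor w i α) j ≡ count w j
  count-factor w i j = trans (count≡trace (factor w i α) j)
      (trans (trace-factor q′ w i j) (sym (count≡trace w j)))

  rotation⇒count-≡ : ∀ {v w} → v IsRotationOf w → ∀ j → count v j ≡ count w j
  rotation⇒count-≡ {w = w} (i , refl) = count-factor w i

  count-balanced : ∀ w → ones w ≡ ρ → Balanced w → ∀ j → count w j ≡ count b j
  count-balanced w ones≡ bal = rotation⇒count-≡ {w} {b} (balanced-rotation α ρ ρ<α w ones≡ bal)

  length-vertices : ∀ w → ones w ≡ ρ → length (cliques q w) ≡ α * q + ρ
  length-vertices w ones≡ = trans (Chain.length-cliques q′ w) (cong (λ c → α * q + c) ones≡)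

  count-bound : ∀ w → ones w ≡ ρ → ∀ j → count w j ≤ 2 ^ (α * q + ρ)
  count-bound w ones≡ j = subst (λ n → count w j ≤ 2 ^ n) (length-vertices w ones≡)
      (indepCount≤2^ (C q w) j)

  BelowBalanced : Word α → ℕ → Set
  BelowBalanced w r = (∀ j → count w j ≤ count b j) × (∀ j → j < 2 * r → count w j ≡ count b j) ×
    (∀ j → 2 * r ≤ j → j ≤ α → count w j < count b j)

  -- Strictness comes from the step itself, so w′ only has to agree with b below 2r. It does if it
  -- is balanced or if its least imbalance length is at least r.
  BelowBalanced-trans : ∀ {w r w′} → Improvement q′ w r w′ →
    (∀ j → count w′ j ≤ count b j) → (∀ j → j < 2 * r → count w′ j ≡ count b j) → BelowBalanced w r
  BelowBalanced-trans imp le eq =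
      (λ j → ≤-trans (improvement-≤ imp j) (le j))
    , (λ j j<2r → trans (improvement-≡ imp j j<2r) (eq j j<2r))
    , (λ j 2r≤j j≤α → <-≤-trans (improvement-< imp j 2r≤j j≤α) (le j))

  -- Each improvement increases i_α, which is bounded.
  unbalanced-below : ∀ fuel w → ones w ≡ ρ → 2 ^ (α * q + ρ) ≤ count w α + fuel →
    ∀ r → IsLeastImbalanceLength w r → BelowBalanced w r
  improved-below : ∀ fuel w r w′ → Improvement q′ w r w′ → ones w ≡ ρ →
    2 ^ (α * q + ρ) ≤ count w α + fuel →
    BelowBalanced w r

  unbalanced-below fuel w ones≡ enough r least =
    let (w′ , imp) = improve q′ w r least in improved-below fuel w r w′ imp ones≡ enough

  improved-below fuel w r w′ imp ones-w enough = conclude fuel enough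
    where
    open Improvement imp using (ones≡; near)
    ones′ : ones w′ ≡ ρ
    ones′ = trans ones≡ ones-w
    lt-α : count w α < count w′ α
    lt-α = improvement-< imp α (improvement⇒2r≤α imp) ≤-refl

    conclude : ∀ fuel → 2 ^ (α * q + ρ) ≤ count w α + fuel → BelowBalanced w r
    -- Without fuel i_α of w would already reach the bound that i_α of w′, though larger, cannot
    -- exceed.
    conclude zero enough = contradiction (<-≤-trans lt-α (≤-trans (count-bound w′ ones′ α) enough))
      (<-irrefl (sym (+-identityʳ (count w α))))
    conclude (suc fuel) enough = [ via-balanced , via-unbalanced ]′ (balanced⊎least w′)
      where
      via-balanced : Balanced w′ → BelowBalanced w r
      via-balanced bal = BelowBalanced-trans imp
        (λ j → ≤-reflexive (count-balanced w′ ones′ bal j)) (λ j _ → count-balanced w′ ones′ bal j)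

      via-unbalanced : ∃ (IsLeastImbalanceLength w′) → BelowBalanced w r
      via-unbalanced (r′ , least′) = BelowBalanced-trans imp
        (proj₁ rest) (λ j j<2r → proj₁ (proj₂ rest) j (<-≤-trans j<2r (*-monoʳ-≤ 2 r≤r′)))
        where
        rest : BelowBalanced w′ r′
        rest = unbalanced-below fuel w′ ones′
          (≤-trans enough (≤-trans (≤-reflexive (+-suc (count w α) fuel))
              (+-monoˡ-≤ fuel lt-α))) r′ least′
        r≤r′ : r ≤ r′
        r≤r′ = ≮⇒≥ λ r′<r → near r′ r′<r (proj₁ least′)

  below-balanced : ∀ w → ones w ≡ ρ → ∀ r → IsLeastImbalanceLength w r → BelowBalanced w r
  below-balanced w ones≡ = unbalanced-below (2 ^ (α * q + ρ)) w ones≡ (m≤n+m _ _)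

  count-≤ : ∀ w → ones w ≡ ρ → ∀ j → count w j ≤ count b j
  count-≤ w ones≡ = [ (λ bal j → ≤-reflexive (count-balanced w ones≡ bal j))
                    , (λ (r , least) → proj₁ (below-balanced w ones≡ r least)) ]′ (balanced⊎least w)

  count-≡⇒balanced : ∀ w → ones w ≡ ρ → count w α ≡ count b α → Balanced w
  count-≡⇒balanced w ones≡ same = [ (λ bal → bal)
    , (λ (r , least) → contradiction same (<⇒≢ (proj₂ (proj₂ (below-balanced w ones≡ r least)) α
        (improvement⇒2r≤α (proj₂ (improve q′ w r least))) ≤-refl))) ]′ (balanced⊎least w)

  private
    α≤vertices : ∀ w → ones w ≡ ρ → α ≤ length (cliques q w)
    α≤vertices w ones≡ = ≤-trans (≤-trans (m≤m*n α q) (m≤m+n (α * q) ρ))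
        (≤-reflexive (sym (length-vertices w ones≡)))

    length-vertices-≡ : ∀ w → ones w ≡ ρ → length (cliques q w) ≡ length (cliques q b)
    length-vertices-≡ w ones≡ = trans (length-vertices w ones≡)
        (sym (length-vertices b (ones-balancedWord α ρ ρ<α)))

  I-⪯cf : ∀ w → ones w ≡ ρ → I (C q w) ⪯cf I (C q b)
  I-⪯cf w ones≡ = indepCount-≤⇒⪯cf {C q w} {C q b} (length-vertices-≡ w ones≡) (count-≤ w ones≡)

  I-≈⇒balanced : ∀ w → ones w ≡ ρ → I (C q w) ≈ I (C q b) → Balanced w
  I-≈⇒balanced w ones≡ I≈ = count-≡⇒balanced w ones≡
    (≈⇒indepCount-≡ {C q w} {C q b} (length-vertices-≡ w ones≡) I≈ (α≤vertices w ones≡))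

  balanced⇒I-≈ : ∀ w → ones w ≡ ρ → Balanced w → I (C q w) ≈ I (C q b)
  balanced⇒I-≈ w ones≡ bal = indepCount-≡⇒≈ {C q w} {C q b} (length-vertices-≡ w ones≡)
      (count-balanced w ones≡ bal)

theorem4p5 : (α q ρ : ℕ) .{{_ : NonZero α}} → 3 ≤ α → 2 ≤ q → (ρ<α : ρ < α) →
    let b = balancedWord α ρ ρ<α in
    (Balanced b × ones b ≡ ρ ×
    ((w : Word α) → ones w ≡ ρ → Balanced w → w IsRotationOf b)) ×
    ((w : Word α) → ones w ≡ ρ →
    (I (C q w) ⪯cf I (C q b)) ×
    (I (C q w) ≈ I (C q b) ⇔ Balanced w) ×
    (¬ Balanced w → (r : ℕ) → IsLeastImbalanceLength w r →
    ((j : ℕ) → j < 2 * r → indepCount (C q w) j ≡ indepCount (C q b) j) ×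
    ((j : ℕ) → 2 * r ≤ j → j ≤ α → indepCount (C q w) j < indepCount (C q b) j)))
theorem4p5 α (suc (suc q′)) ρ 3≤α (s≤s (s≤s z≤n)) ρ<α =
  (balancedWord-balanced α ρ ρ<α , ones-balancedWord α ρ ρ<α , balanced-rotation α ρ ρ<α) ,
  λ w ones≡ →
    I-⪯cf w ones≡ ,
    mk⇔ (I-≈⇒balanced w ones≡) (balanced⇒I-≈ w ones≡) ,
    λ _ r least → proj₂ (below-balanced w ones≡ r least)
  where open Comparison q′ ρ (<⇒≤ 3≤α) ρ<α
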